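{- For every integer $t \geq 3$ there is a constant $c>0$ such that for every positive integer $n$, \[\overline{R}(\mathcal{K}^{(3)}_{t+1},\mathcal{K}^{(3)}_3(n)) \geq 2^{c\, n \log{n}}.\]
   Context: Ordered $3$-uniform hypergraphs are $3$-uniform hypergraphs with a linear ordering of their vertex sets; copies must preserve the orderings. $\mathcal{K}^{(3)}_{m}$ is the ordered complete $3$-uniform hypergraph on $m$ vertices. $\mathcal{K}^{(3)}_3(n)$ is the ordered complete $3$-uniform tripartite hypergraph whose vertex set consists of three consecutive intervals of $n$ vertices each, with hyperedges exactly the triples having one vertex in each interval. $\overline{R}(\mathcal{H},\mathcal{G})$ is the smallest $N$ such that every red-blue coloring of the hyperedges of $\mathcal{K}^{(3)}_N$ contains a blue ordered copy of $\mathcal{H}$ or a red ordered copy of $\mathcal{G}$. $\log$ is base $2$. -}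

module Defs where

open import Data.Nat using (ℕ; _+_; _*_; _<_; _≤_)
open import Data.Fin using (Fin; toℕ)
open import Data.Product using (Σ; _×_)
open import Data.Sum using (_⊎_)
open import Relation.Binary.PropositionalEquality using (_≡_)

data Colour : Set where
  red blue : Colour

-- An ordered 3-uniform hypergraph on the vertex set Fin m (ordered by Fin's
-- natural order), given by its edge predicate on triples i < j < k.
record OrdHyp : Set₁ where
  field
    size : ℕ
    Edge : Fin size → Fin size → Fin size → Set

open OrdHyp public

-- A red-blue colouring of the hyperedges of K^(3)_N: a colour for every
-- triple; only triples with i < j < k (the hyperedges) are ever consulted.
Colouring : ℕ → Set
Colouring N = Fin N → Fin N → Fin N → Colour

StrictlyIncreasing : {m N : ℕ} → (Fin m → Fin N) → Set
StrictlyIncreasing {m} f = (i j : Fin m) → toℕ i < toℕ j → toℕ (f i) < toℕ (f j)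

HasCopy : {N : ℕ} → Colouring N → Colour → OrdHyp → Set
HasCopy {N} χ c H =
  Σ (Fin (size H) → Fin N) λ f →
    StrictlyIncreasing f ×
    ((i j k : Fin (size H)) → toℕ i < toℕ j → toℕ j < toℕ k →
       Edge H i j k → χ (f i) (f j) (f k) ≡ c)

K3 : ℕ → OrdHyp
K3 m = record { size = m ; Edge = λ i j k → toℕ i < toℕ j × toℕ j < toℕ k }

K3tri : ℕ → OrdHyp
K3tri n = record
  { size = 3 * n
  ; Edge = λ i j k → toℕ i < n × (n ≤ toℕ j × toℕ j < 2 * n) × 2 * n ≤ toℕ k
  }

-- N has the Ramsey property for (H, G): every red-blue colouring of K^(3)_N
-- contains a blue ordered copy of H or a red ordered copy of G.
-- The ordered Ramsey number R̄(H,G) is the least such N.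
Arrows : ℕ → OrdHyp → OrdHyp → Set
Arrows N H G = (χ : Colouring N) → HasCopy χ blue H ⊎ HasCopy χ red G

-- "R̄(H,G) ≥ M" means: every N with the Ramsey property satisfies M ≤ N.

module Submission where

-- Since K₄ ⊆ K_{t+1}, it is enough to avoid a blue K₄.  Let D be a digraph on l vertices without
-- transitive triangles, give each vertex a of K_N a uniformly random map f_a to D, and colour a < b < c
-- blue iff f_a(b) → f_a(c) in D.  A blue K₄ with least vertex a would map to a transitive triangle.
--
-- For D take the flags of the affine plane over a field with q elements, l = q³, with (p, ℓ) → (p′, ℓ′)
-- iff p ∈ ℓ′, p ≠ p′ and ℓ ≠ ℓ′: two distinct lines share at most one point, so no transitive triangle
-- exists, and by a second moment computation sets S, T without an edge from S to T have |S||T| ≤ 5q⁵.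
-- For a given position of a red K₃(n), each vertex a of its first interval forces a pair (S, T) without
-- edges with f_a(B) ⊆ S and f_a(C) ⊆ T, so the union bound gives l^(2n) ≤ N³ · 2^l · (5q⁵)ⁿ if every
-- colouring contains a red copy.  With q³ ≤ n ≤ q⁶ this is qⁿ ≤ N³ · 10ⁿ, whence nⁿ ≤ N³⁶.

open import Defs
open import Data.Nat hiding (_≟_)
open import Data.Nat.DivMod using (_mod_)
open import Data.Nat.Properties hiding (_≟_)
open import Data.Nat.Solver using (module +-*-Solver)
open import Algebra.Bundles using (CommutativeSemiring)
open import Algebra.Properties.CommutativeSemigroup +-commutativeSemigroup using (interchange)
import Algebra.Solver.Ring.NaturalCoefficients.Default as SemiringSolver
open import Algebra.Structures using (IsCommutativeSemiring)
open import Algebra.Structures.Biased using (isCommutativeSemiringˡ)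
open import Data.Bool using (if_then_else_)
open import Data.Empty using (⊥)
open import Data.Fin as Fin using (Fin; zero; suc; toℕ; splitAt; _↑ˡ_; _↑ʳ_)
import Data.Fin.Patterns as Fin
import Data.Fin.Properties as Fin
open import Data.List using (List; []; _∷_; _++_; map; length; cartesianProduct; cartesianProductWith; filter; allFin)
open import Data.List.Properties using (length-++; length-map; length-filter; length-tabulate)
import Data.List.Membership.DecPropositional as DecMembership
open import Data.List.Membership.Propositional using (_∈_)
open import Data.List.Membership.Propositional.Properties
  using (∈-++⁺ˡ; ∈-++⁺ʳ; ∈-map⁺; ∈-allFin; ∈-filter⁺; ∈-filter⁻; ∈-cartesianProduct⁺; ∈-cartesianProductWith⁺)
open import Data.List.Relation.Unary.All as All using ()
open import Data.List.Relation.Unary.AllPairs using ([]; _∷_)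
open import Data.List.Relation.Unary.Any using (here; there)
open import Data.List.Relation.Unary.Unique.Propositional using (Unique)
open import Data.List.Relation.Unary.Unique.Propositional.Properties using (cartesianProduct⁺; allFin⁺)
open import Data.Product using (Σ; ∃; _×_; _,_; proj₁; proj₂)
open import Data.Product.Properties using (≡-dec)
open import Data.Sum using (_⊎_; inj₁; inj₂; [_,_]′)
open import Data.Vec using (Vec; []; _∷_; lookup; tabulate; insertAt)
open import Data.Vec.Properties using (insertAt-lookup; insertAt-punchIn; lookup∘tabulate)
open import Function using (_∘_; id; it; Injective)
open import Relation.Binary using (DecidableEquality; tri<; tri≈; tri>)
open import Relation.Binary.PropositionalEquality
open import Relation.Nullary using (Dec; yes; no; does; ¬_; contradiction; _×-dec_; _⊎-dec_; ¬?; _→-dec_)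
open import Relation.Nullary.Decidable using (from-yes)
open import Relation.Unary using (Decidable)

private variable
  A B C P Q : Set

-- Indicators of decidable propositions

⟦_⟧ : Dec P → ℕ
⟦ d ⟧ = if does d then 1 else 0

⟦⟧≤1 : (d : Dec P) → ⟦ d ⟧ ≤ 1
⟦⟧≤1 (yes _) = ≤-refl
⟦⟧≤1 (no _)  = z≤n

⟦⟧-yes : (d : Dec P) → P → ⟦ d ⟧ ≡ 1
⟦⟧-yes (yes _) _ = refl
⟦⟧-yes (no ¬p) p = contradiction p ¬p

⟦⟧-no : (d : Dec P) → ¬ P → ⟦ d ⟧ ≡ 0
⟦⟧-no (yes p) ¬p = contradiction p ¬p
⟦⟧-no (no _)  _  = refl

⟦⟧-mono : (d : Dec P) (e : Dec Q) → (P → Q) → ⟦ d ⟧ ≤ ⟦ e ⟧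
⟦⟧-mono (yes p) e f = ≤-reflexive (sym (⟦⟧-yes e (f p)))
⟦⟧-mono (no _)  e f = z≤n

⟦⟧-cong : (d : Dec P) (e : Dec Q) → (P → Q) → (Q → P) → ⟦ d ⟧ ≡ ⟦ e ⟧
⟦⟧-cong d e f g = ≤-antisym (⟦⟧-mono d e f) (⟦⟧-mono e d g)

⟦⟧-× : (d : Dec P) (e : Dec Q) → ⟦ d ×-dec e ⟧ ≡ ⟦ d ⟧ * ⟦ e ⟧
⟦⟧-× (yes _) e = sym (*-identityˡ ⟦ e ⟧)
⟦⟧-× (no _)  e = refl

⟦⟧-¬ : (d : Dec P) → ⟦ ¬? d ⟧ + ⟦ d ⟧ ≡ 1
⟦⟧-¬ (yes _) = refl
⟦⟧-¬ (no _)  = refl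

-- Sums over lists

∑ : List A → (A → ℕ) → ℕ
∑ []       f = 0
∑ (x ∷ xs) f = f x + ∑ xs f

∑-cong : (xs : List A) {f g : A → ℕ} → (∀ x → f x ≡ g x) → ∑ xs f ≡ ∑ xs g
∑-cong []       eq = refl
∑-cong (x ∷ xs) eq = cong₂ _+_ (eq x) (∑-cong xs eq)

∑-mono-∈ : (xs : List A) {f g : A → ℕ} → (∀ {x} → x ∈ xs → f x ≤ g x) → ∑ xs f ≤ ∑ xs g
∑-mono-∈ []       le = z≤n
∑-mono-∈ (x ∷ xs) le = +-mono-≤ (le (here refl)) (∑-mono-∈ xs (le ∘ there))

∑-mono : (xs : List A) {f g : A → ℕ} → (∀ x → f x ≤ g x) → ∑ xs f ≤ ∑ xs g
∑-mono xs le = ∑-mono-∈ xs (λ {x} _ → le x)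

∑-const : (xs : List A) (c : ℕ) → ∑ xs (λ _ → c) ≡ length xs * c
∑-const []       c = refl
∑-const (x ∷ xs) c = cong (c +_) (∑-const xs c)

∑-one : (xs : List A) → ∑ xs (λ _ → 1) ≡ length xs
∑-one xs = trans (∑-const xs 1) (*-identityʳ _)

∑-+ : (xs : List A) (f g : A → ℕ) → ∑ xs (λ x → f x + g x) ≡ ∑ xs f + ∑ xs g
∑-+ []       f g = refl
∑-+ (x ∷ xs) f g = begin
  f x + g x + ∑ xs (λ x → f x + g x)   ≡⟨ cong (f x + g x +_) (∑-+ xs f g) ⟩
  f x + g x + (∑ xs f + ∑ xs g)        ≡⟨ interchange (f x) (g x) (∑ xs f) (∑ xs g) ⟩
  f x + ∑ xs f + (g x + ∑ xs g)        ∎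
  where open ≡-Reasoning

∑-*ˡ : (xs : List A) (c : ℕ) (f : A → ℕ) → ∑ xs (λ x → c * f x) ≡ c * ∑ xs f
∑-*ˡ []       c f = sym (*-zeroʳ c)
∑-*ˡ (x ∷ xs) c f = trans (cong (c * f x +_) (∑-*ˡ xs c f)) (sym (*-distribˡ-+ c _ _))

∑-*ʳ : (xs : List A) (f : A → ℕ) (c : ℕ) → ∑ xs (λ x → f x * c) ≡ ∑ xs f * c
∑-*ʳ xs f c = begin
  ∑ xs (λ x → f x * c)  ≡⟨ ∑-cong xs (λ x → *-comm (f x) c) ⟩
  ∑ xs (λ x → c * f x)  ≡⟨ ∑-*ˡ xs c f ⟩
  c * ∑ xs f            ≡⟨ *-comm c _ ⟩
  ∑ xs f * c            ∎
  where open ≡-Reasoning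

∑-swap : (xs : List A) (ys : List B) (f : A → B → ℕ) →
  ∑ xs (λ x → ∑ ys (f x)) ≡ ∑ ys (λ y → ∑ xs (λ x → f x y))
∑-swap []       ys f = sym (trans (∑-const ys 0) (*-zeroʳ (length ys)))
∑-swap (x ∷ xs) ys f = begin
  ∑ ys (f x) + ∑ xs (λ x → ∑ ys (f x))                ≡⟨ cong (∑ ys (f x) +_) (∑-swap xs ys f) ⟩
  ∑ ys (f x) + ∑ ys (λ y → ∑ xs (λ x → f x y))        ≡⟨ ∑-+ ys (f x) _ ⟨
  ∑ ys (λ y → f x y + ∑ xs (λ x → f x y))             ∎
  where open ≡-Reasoning

∑-++ : (xs ys : List A) (f : A → ℕ) → ∑ (xs ++ ys) f ≡ ∑ xs f + ∑ ys f
∑-++ []       ys f = refl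
∑-++ (x ∷ xs) ys f = trans (cong (f x +_) (∑-++ xs ys f)) (sym (+-assoc (f x) _ _))

∑-map : (g : A → B) (xs : List A) (f : B → ℕ) → ∑ (map g xs) f ≡ ∑ xs (f ∘ g)
∑-map g []       f = refl
∑-map g (x ∷ xs) f = cong (f (g x) +_) (∑-map g xs f)

∑-product : (g : A → B → C) (xs : List A) (ys : List B) (f : C → ℕ) →
  ∑ (cartesianProductWith g xs ys) f ≡ ∑ xs (λ x → ∑ ys (λ y → f (g x y)))
∑-product g []       ys f = refl
∑-product g (x ∷ xs) ys f = begin
  ∑ (map (g x) ys ++ cartesianProductWith g xs ys) f       ≡⟨ ∑-++ (map (g x) ys) _ f ⟩
  ∑ (map (g x) ys) f + ∑ (cartesianProductWith g xs ys) f  ≡⟨ cong₂ _+_ (∑-map (g x) ys f) (∑-product g xs ys f) ⟩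
  ∑ ys (f ∘ g x) + ∑ xs (λ x → ∑ ys (λ y → f (g x y)))     ∎
  where open ≡-Reasoning

∈⇒≤∑ : {xs : List A} {x : A} (f : A → ℕ) → x ∈ xs → f x ≤ ∑ xs f
∈⇒≤∑ f (here refl) = m≤m+n _ _
∈⇒≤∑ f (there x∈)  = ≤-trans (∈⇒≤∑ f x∈) (m≤n+m _ _)

∑-≡0 : (xs : List A) (f : A → ℕ) → (∀ {x} → x ∈ xs → f x ≡ 0) → ∑ xs f ≡ 0
∑-≡0 []       f eq = refl
∑-≡0 (x ∷ xs) f eq = cong₂ _+_ (eq (here refl)) (∑-≡0 xs f (eq ∘ there))

module _ (_≟_ : DecidableEquality A) where

  ∑-δ : {xs : List A} {a : A} → Unique xs → a ∈ xs → (f : A → ℕ) →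
    ∑ xs (λ x → ⟦ x ≟ a ⟧ * f x) ≡ f a
  ∑-δ {a = a} (a∉ ∷ u) (here {xs = xs} refl) f = begin
    ⟦ a ≟ a ⟧ * f a + ∑ xs (λ x → ⟦ x ≟ a ⟧ * f x)
      ≡⟨ cong₂ _+_ (cong (_* f a) (⟦⟧-yes (a ≟ a) refl))
           (∑-≡0 xs _ (λ {x} x∈ → cong (_* f x) (⟦⟧-no (x ≟ a) (λ x≡a → All.lookup a∉ x∈ (sym x≡a))))) ⟩
    1 * f a + 0  ≡⟨ trans (+-identityʳ _) (*-identityˡ _) ⟩
    f a          ∎
    where open ≡-Reasoning
  ∑-δ {x ∷ xs} {a} (x∉ ∷ u) (there a∈) f =
    cong₂ _+_ (cong (_* f x) (⟦⟧-no (x ≟ a) (All.lookup x∉ a∈))) (∑-δ u a∈ f)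

  ∑-δ₁ : {xs : List A} {a : A} → Unique xs → a ∈ xs → ∑ xs (λ x → ⟦ x ≟ a ⟧) ≡ 1
  ∑-δ₁ {xs} {a} u a∈ = trans (∑-cong xs (λ x → sym (*-identityʳ ⟦ x ≟ a ⟧))) (∑-δ u a∈ (λ _ → 1))

∑-⟦⟧≤1 : {P : A → Set} (P? : Decidable P) {xs : List A} → Unique xs →
  (∀ {x y} → P x → P y → x ≡ y) → ∑ xs (λ x → ⟦ P? x ⟧) ≤ 1
∑-⟦⟧≤1 P? []       inj = z≤n
∑-⟦⟧≤1 P? (_∷_ {x} {xs} x∉ u) inj with P? x
... | no _  = ∑-⟦⟧≤1 P? u inj
... | yes p = s≤s (≤-reflexive (∑-≡0 xs _
                (λ {y} y∈ → ⟦⟧-no (P? y) (λ py → All.lookup x∉ y∈ (inj p py)))))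

-- Weights replace the indicators of the bad events. Being at least 1 on an event is all that
-- counts, so they can be built from sums and products that factor under averaging.
union-bound : (Ω : List A) (E : List B) (w : B → A → ℕ) →
  (∀ ω → ∃ λ e → e ∈ E × 1 ≤ w e ω) → length Ω ≤ ∑ E (λ e → ∑ Ω (w e))
union-bound Ω E w catch = begin
  length Ω                        ≡⟨ ∑-one Ω ⟨
  ∑ Ω (λ _ → 1)                   ≤⟨ ∑-mono Ω (λ ω → let e , e∈ , le = catch ω in ≤-trans le (∈⇒≤∑ (λ e → w e ω) e∈)) ⟩
  ∑ Ω (λ ω → ∑ E (λ e → w e ω))   ≡⟨ ∑-swap Ω E (λ ω e → w e ω) ⟩
  ∑ E (λ e → ∑ Ω (w e))           ∎
  where open ≤-Reasoning

-- Products, and sums over all vectors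

∏ : (n : ℕ) → (Fin n → ℕ) → ℕ
∏ zero    f = 1
∏ (suc n) f = f zero * ∏ n (f ∘ suc)

∏-cong : ∀ n {f g : Fin n → ℕ} → (∀ i → f i ≡ g i) → ∏ n f ≡ ∏ n g
∏-cong zero    eq = refl
∏-cong (suc n) eq = cong₂ _*_ (eq zero) (∏-cong n (eq ∘ suc))

∏-const : ∀ n c → ∏ n (λ _ → c) ≡ c ^ n
∏-const zero    c = refl
∏-const (suc n) c = cong (c *_) (∏-const n c)

∏-+ : ∀ m n (f : Fin (m + n) → ℕ) → ∏ (m + n) f ≡ ∏ m (λ i → f (i ↑ˡ n)) * ∏ n (λ j → f (m ↑ʳ j))
∏-+ zero    n f = sym (+-identityʳ _)
∏-+ (suc m) n f = trans (cong (f zero *_) (∏-+ m n (f ∘ suc))) (sym (*-assoc (f zero) _ _))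

∏≥1 : ∀ n {f : Fin n → ℕ} → (∀ i → 1 ≤ f i) → 1 ≤ ∏ n f
∏≥1 zero    le = ≤-refl
∏≥1 (suc n) le = *-mono-≤ (le zero) (∏≥1 n (le ∘ suc))

vecs : List A → (n : ℕ) → List (Vec A n)
vecs xs zero    = [] ∷ []
vecs xs (suc n) = cartesianProductWith _∷_ xs (vecs xs n)

length-product : (g : A → B → C) (xs : List A) (ys : List B) →
  length (cartesianProductWith g xs ys) ≡ length xs * length ys
length-product g []       ys = refl
length-product g (x ∷ xs) ys =
  trans (length-++ (map (g x) ys)) (cong₂ _+_ (length-map (g x) ys) (length-product g xs ys))

length-vecs : (xs : List A) (n : ℕ) → length (vecs xs n) ≡ length xs ^ n
length-vecs xs zero    = refl
length-vecs xs (suc n) = trans (length-product _∷_ xs (vecs xs n)) (cong (length xs *_) (length-vecs xs n))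

-- Singles out the coordinate `p`, which is how `∑-vecs-∏` peels off one factor.
∑-vecs-insertAt : (xs : List A) (n : ℕ) (p : Fin (suc n)) (f : Vec A (suc n) → ℕ) →
  ∑ (vecs xs (suc n)) f ≡ ∑ xs (λ x → ∑ (vecs xs n) (λ v → f (insertAt v p x)))
∑-vecs-insertAt xs n zero f = ∑-product _∷_ xs (vecs xs n) f
∑-vecs-insertAt xs (suc n) (suc p) f = begin
  ∑ (vecs xs (2 + n)) f
    ≡⟨ ∑-product _∷_ xs (vecs xs (suc n)) f ⟩
  ∑ xs (λ y → ∑ (vecs xs (suc n)) (λ v → f (y ∷ v)))
    ≡⟨ ∑-cong xs (λ y → ∑-vecs-insertAt xs n p (λ v → f (y ∷ v))) ⟩
  ∑ xs (λ y → ∑ xs (λ x → ∑ (vecs xs n) (λ v → f (y ∷ insertAt v p x))))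
    ≡⟨ ∑-swap xs xs _ ⟩
  ∑ xs (λ x → ∑ xs (λ y → ∑ (vecs xs n) (λ v → f (y ∷ insertAt v p x))))
    ≡⟨ ∑-cong xs (λ x → sym (∑-product _∷_ xs (vecs xs n) (λ v → f (insertAt v (suc p) x)))) ⟩
  ∑ xs (λ x → ∑ (vecs xs (suc n)) (λ v → f (insertAt v (suc p) x))) ∎
  where open ≡-Reasoning

-- The entries of a uniformly random vector at distinct positions are independent.
∑-vecs-∏ : (xs : List A) (N k : ℕ) (ι : Fin k → Fin N) → Injective _≡_ _≡_ ι → (F : Fin k → A → ℕ) →
  ∑ (vecs xs N) (λ v → ∏ k (λ i → F i (lookup v (ι i)))) * length xs ^ k
    ≡ length xs ^ N * ∏ k (λ i → ∑ xs (F i))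
∑-vecs-∏ xs N zero ι inj F =
  cong (_* 1) (trans (∑-one (vecs xs N)) (length-vecs xs N))
∑-vecs-∏ xs zero (suc k) ι inj F with () ← ι zero
∑-vecs-∏ xs (suc N) (suc k) ι inj F = begin
  ∑ (vecs xs (suc N)) (λ v → F zero (lookup v p) * rest v) * (l * l ^ k)
    ≡⟨ cong (_* (l * l ^ k)) (∑-vecs-insertAt xs N p _) ⟩
  ∑ xs (λ x → ∑ (vecs xs N) (λ v → F zero (lookup (insertAt v p x) p) * rest (insertAt v p x))) * (l * l ^ k)
    ≡⟨ cong (_* (l * l ^ k)) (∑-cong xs (λ x → ∑-cong (vecs xs N) (λ v →
         cong₂ _*_ (cong (F zero) (insertAt-lookup v p x)) (∏-cong k (λ i → cong (F (suc i)) (at v x i)))))) ⟩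
  ∑ xs (λ x → ∑ (vecs xs N) (λ v → F zero x * rest′ v)) * (l * l ^ k)
    ≡⟨ cong (_* (l * l ^ k)) (∑-cong xs (λ x → ∑-*ˡ (vecs xs N) (F zero x) rest′)) ⟩
  ∑ xs (λ x → F zero x * ∑ (vecs xs N) rest′) * (l * l ^ k)
    ≡⟨ cong (_* (l * l ^ k)) (∑-*ʳ xs (F zero) _) ⟩
  ∑ xs (F zero) * R * (l * l ^ k)
    ≡⟨ regroup (∑ xs (F zero)) R l (l ^ k) ⟩
  l * (∑ xs (F zero) * (R * l ^ k))
    ≡⟨ cong (λ z → l * (∑ xs (F zero) * z)) (∑-vecs-∏ xs N k ι′ inj′ (F ∘ suc)) ⟩
  l * (∑ xs (F zero) * (l ^ N * ∏ k (λ i → ∑ xs (F (suc i)))))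
    ≡⟨ regroup′ (∑ xs (F zero)) (l ^ N) l _ ⟩
  l * l ^ N * (∑ xs (F zero) * ∏ k (λ i → ∑ xs (F (suc i)))) ∎
  where
  open ≡-Reasoning
  open +-*-Solver using (solve; _:=_; _:*_)
  l = length xs
  p = ι zero
  p≢ : ∀ i → p ≢ ι (suc i)
  p≢ i eq with () ← inj eq
  -- Once coordinate `p` is removed, the other positions are renumbered by `punchOut`, which keeps
  -- them distinct.
  ι′ : Fin k → Fin N
  ι′ i = Fin.punchOut (p≢ i)
  inj′ : Injective _≡_ _≡_ ι′
  inj′ {i} {j} eq = Fin.suc-injective (inj (Fin.punchOut-injective (p≢ i) (p≢ j) eq))
  rest : Vec _ (suc N) → ℕ
  rest v = ∏ k (λ i → F (suc i) (lookup v (ι (suc i))))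
  rest′ : Vec _ N → ℕ
  rest′ v = ∏ k (λ i → F (suc i) (lookup v (ι′ i)))
  R = ∑ (vecs xs N) rest′
  at : ∀ v x i → lookup (insertAt v p x) (ι (suc i)) ≡ lookup v (ι′ i)
  at v x i = trans (cong (lookup (insertAt v p x)) (sym (Fin.punchIn-punchOut (p≢ i))))
                   (insertAt-punchIn v p x (ι′ i))
  regroup : ∀ a b c d → a * b * (c * d) ≡ c * (a * (b * d))
  regroup = solve 4 (λ a b c d → a :* b :* (c :* d) := c :* (a :* (b :* d))) refl
  regroup′ : ∀ a b c d → c * (a * (b * d)) ≡ c * b * (a * d)
  regroup′ = solve 4 (λ a b c d → c :* (a :* (b :* d)) := c :* b :* (a :* d)) refl

sublists : List A → List (List A)
sublists []       = [] ∷ []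
sublists (x ∷ xs) = sublists xs ++ map (x ∷_) (sublists xs)

length-sublists : (xs : List A) → length (sublists xs) ≡ 2 ^ length xs
length-sublists []       = refl
length-sublists (x ∷ xs) = begin
  length (sublists xs ++ map (x ∷_) (sublists xs))          ≡⟨ length-++ (sublists xs) ⟩
  length (sublists xs) + length (map (x ∷_) (sublists xs))  ≡⟨ cong (length (sublists xs) +_) (length-map (x ∷_) (sublists xs)) ⟩
  length (sublists xs) + length (sublists xs)               ≡⟨ cong₂ _+_ (length-sublists xs) (length-sublists xs) ⟩
  2 ^ length xs + 2 ^ length xs                             ≡⟨ cong (2 ^ length xs +_) (sym (+-identityʳ _)) ⟩
  2 ^ length (x ∷ xs)                                       ∎
  where open ≡-Reasoning

-- Places every decidable set of vertices among the 2^l candidates for S in the union bound.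
filter∈sublists : {P : A → Set} (P? : Decidable P) (xs : List A) → filter P? xs ∈ sublists xs
filter∈sublists P? []       = here refl
filter∈sublists P? (x ∷ xs) with P? x
... | yes _ = ∈-++⁺ʳ (sublists xs) (∈-map⁺ (x ∷_) (filter∈sublists P? xs))
... | no _  = ∈-++⁺ˡ (filter∈sublists P? xs)

-- A tower of finite fields

-- A finite integral domain, with −1 supplied as i² so that all its identities are semiring identities.
-- The non-square d, together with i, survives adjoining √d, which squares the number of elements.
record FiniteDomain : Set₁ where
  infixl 6 _⊕_
  infixl 7 _⊗_
  infix 4 _≟_
  field
    F        : Set
    _⊕_ _⊗_  : F → F → F
    0F 1F i d : F
    isCommutativeSemiring : IsCommutativeSemiring _≡_ _⊕_ _⊗_ 0F 1F
    1+i²≡0    : 1F ⊕ i ⊗ i ≡ 0F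
    integral  : ∀ {x y} → x ⊗ y ≡ 0F → x ≡ 0F ⊎ y ≡ 0F
    nonsquare : ∀ {a b} → a ⊗ a ≡ d ⊗ (b ⊗ b) → b ≡ 0F
    _≟_       : DecidableEquality F
    els       : List F
    complete  : ∀ x → x ∈ els
    unique    : Unique els

  commutativeSemiring : CommutativeSemiring _ _
  commutativeSemiring = record { isCommutativeSemiring = isCommutativeSemiring }

  open IsCommutativeSemiring isCommutativeSemiring public
    using (zeroˡ; zeroʳ)
    renaming (+-identityˡ to ⊕-identityˡ; +-identityʳ to ⊕-identityʳ; +-comm to ⊕-comm; *-identityˡ to ⊗-identityˡ)
  open SemiringSolver commutativeSemiring public
    using (solve; _:=_; _:+_; _:*_; con)

  order : ℕ
  order = length els

  -- This is -1, so that `a ⊕ n ⊗ b` reads a - b.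
  n : F
  n = i ⊗ i

  -- The semiring solver knows no negatives. An identity that rests on 1 + n = 0 is proved by
  -- inserting or removing an explicit multiple of `1F ⊕ n` here and leaving the rest to the solver.
  vanish : ∀ a b → a ⊕ (1F ⊕ n) ⊗ b ≡ a
  vanish a b = trans (cong (a ⊕_) (trans (cong (_⊗ b) 1+i²≡0) (zeroˡ b))) (⊕-identityʳ a)

  ⊕-solution : ∀ z w → z ⊕ (w ⊕ n ⊗ z) ≡ w
  ⊕-solution z w =
    trans (solve 3 (λ z w n → z :+ (w :+ n :* z) := w :+ (con 1 :+ n) :* z) refl z w n) (vanish w z)

  n²≡1 : n ⊗ n ≡ 1F
  n²≡1 = begin
    n ⊗ n                      ≡⟨ vanish (n ⊗ n) 1F ⟨
    n ⊗ n ⊕ (1F ⊕ n) ⊗ 1F      ≡⟨ solve 1 (λ n → n :* n :+ (con 1 :+ n) :* con 1 := con 1 :+ (con 1 :+ n) :* n) refl n ⟩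
    1F ⊕ (1F ⊕ n) ⊗ n          ≡⟨ vanish 1F n ⟩
    1F                         ∎
    where open ≡-Reasoning

  ⊕-cancelʳ : ∀ c {a b} → a ⊕ c ≡ b ⊕ c → a ≡ b
  ⊕-cancelʳ c {a} {b} eq = begin
    a                    ≡⟨ vanish a c ⟨
    a ⊕ (1F ⊕ n) ⊗ c     ≡⟨ regroup a ⟩
    (a ⊕ c) ⊕ n ⊗ c      ≡⟨ cong (_⊕ n ⊗ c) eq ⟩
    (b ⊕ c) ⊕ n ⊗ c      ≡⟨ regroup b ⟨
    b ⊕ (1F ⊕ n) ⊗ c     ≡⟨ vanish b c ⟩
    b                    ∎
    where
    open ≡-Reasoning
    regroup : ∀ a → a ⊕ (1F ⊕ n) ⊗ c ≡ (a ⊕ c) ⊕ n ⊗ c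
    regroup a = solve 3 (λ a c n → a :+ (con 1 :+ n) :* c := (a :+ c) :+ n :* c) refl a c n

  difference≡0 : ∀ {a b} → a ⊕ n ⊗ b ≡ 0F → a ≡ b
  difference≡0 {a} {b} eq = ⊕-cancelʳ (n ⊗ b) (trans eq (sym (begin
    b ⊕ n ⊗ b           ≡⟨ solve 2 (λ b n → b :+ n :* b := con 0 :+ (con 1 :+ n) :* b) refl b n ⟩
    0F ⊕ (1F ⊕ n) ⊗ b   ≡⟨ vanish 0F b ⟩
    0F                  ∎)))
    where open ≡-Reasoning

  -- Subtracting the two equations gives (m - m′)(x - x′) = 0, and the second factor is non-zero.
  lines-meet-once : ∀ {m k m′ k′ x x′} → m ⊗ x ⊕ k ≡ m′ ⊗ x ⊕ k′ → m ⊗ x′ ⊕ k ≡ m′ ⊗ x′ ⊕ k′ →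
    x ≢ x′ → m ≡ m′ × k ≡ k′
  lines-meet-once {m} {k} {m′} {k′} {x} {x′} eq eq′ x≢x′
    = [ same-slope , (λ x-x′≡0 → contradiction (difference≡0 x-x′≡0) x≢x′) ]′ (integral product≡0)
    where
    open ≡-Reasoning
    exchange : m ⊗ x ⊕ m′ ⊗ x′ ≡ m ⊗ x′ ⊕ m′ ⊗ x
    exchange = ⊕-cancelʳ (k ⊕ k′) (begin
      m ⊗ x ⊕ m′ ⊗ x′ ⊕ (k ⊕ k′)
        ≡⟨ solve 4 (λ a b k k′ → a :+ b :+ (k :+ k′) := (a :+ k) :+ (b :+ k′)) refl (m ⊗ x) (m′ ⊗ x′) k k′ ⟩
      (m ⊗ x ⊕ k) ⊕ (m′ ⊗ x′ ⊕ k′)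
        ≡⟨ cong₂ _⊕_ eq (sym eq′) ⟩
      (m′ ⊗ x ⊕ k′) ⊕ (m ⊗ x′ ⊕ k)
        ≡⟨ solve 4 (λ a b k k′ → (b :+ k′) :+ (a :+ k) := a :+ b :+ (k :+ k′)) refl (m ⊗ x′) (m′ ⊗ x) k k′ ⟩
      m ⊗ x′ ⊕ m′ ⊗ x ⊕ (k ⊕ k′) ∎)
    product≡0 : (m ⊕ n ⊗ m′) ⊗ (x ⊕ n ⊗ x′) ≡ 0F
    product≡0 = begin
      (m ⊕ n ⊗ m′) ⊗ (x ⊕ n ⊗ x′)
        ≡⟨ solve 5 (λ m m′ x x′ n → (m :+ n :* m′) :* (x :+ n :* x′) :=
             (m :* x :+ n :* n :* (m′ :* x′)) :+ n :* (m :* x′ :+ m′ :* x)) refl m m′ x x′ n ⟩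
      (m ⊗ x ⊕ n ⊗ n ⊗ (m′ ⊗ x′)) ⊕ n ⊗ (m ⊗ x′ ⊕ m′ ⊗ x)
        ≡⟨ cong₂ (λ s t → (m ⊗ x ⊕ s) ⊕ n ⊗ t)
             (trans (cong (_⊗ (m′ ⊗ x′)) n²≡1) (⊗-identityˡ _)) (sym exchange) ⟩
      (m ⊗ x ⊕ m′ ⊗ x′) ⊕ n ⊗ (m ⊗ x ⊕ m′ ⊗ x′)
        ≡⟨ solve 2 (λ s n → s :+ n :* s := con 0 :+ (con 1 :+ n) :* s) refl (m ⊗ x ⊕ m′ ⊗ x′) n ⟩
      0F ⊕ (1F ⊕ n) ⊗ (m ⊗ x ⊕ m′ ⊗ x′)
        ≡⟨ vanish 0F _ ⟩
      0F ∎
    same-slope : m ⊕ n ⊗ m′ ≡ 0F → m ≡ m′ × k ≡ k′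
    same-slope m-m′≡0 = m≡m′ , ⊕-cancelʳ (m ⊗ x) (begin
      k ⊕ m ⊗ x     ≡⟨ ⊕-comm k _ ⟩
      m ⊗ x ⊕ k     ≡⟨ eq ⟩
      m′ ⊗ x ⊕ k′   ≡⟨ cong (λ m → m ⊗ x ⊕ k′) m≡m′ ⟨
      m ⊗ x ⊕ k′    ≡⟨ ⊕-comm _ k′ ⟩
      k′ ⊕ m ⊗ x    ∎)
      where
      m≡m′ : m ≡ m′
      m≡m′ = difference≡0 m-m′≡0

module Tower (R : FiniteDomain) where
  open FiniteDomain R renaming (F to K)

  -- The norm a² - d b² of a + b√d.
  norm : K → K → K
  norm a b = a ⊗ a ⊕ n ⊗ (d ⊗ (b ⊗ b))

  norm≡0 : ∀ a b → norm a b ≡ 0F → a ≡ 0F × b ≡ 0F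
  norm≡0 a b N≡0 = [ id , id ]′ (integral a²≡0) , b≡0
    where
    b≡0 : b ≡ 0F
    b≡0 = nonsquare (difference≡0 N≡0)
    a²≡0 : a ⊗ a ≡ 0F
    a²≡0 = trans (difference≡0 N≡0)
      (trans (cong (λ b → d ⊗ (b ⊗ b)) b≡0) (trans (cong (d ⊗_) (zeroˡ 0F)) (zeroʳ d)))

  infixl 6 _+′_
  infixl 7 _*′_
  -- The pair (a , b) stands for a + b√d.
  _+′_ _*′_ : K × K → K × K → K × K
  (a , b) +′ (c , e) = a ⊕ c , b ⊕ e
  (a , b) *′ (c , e) = a ⊗ c ⊕ d ⊗ (b ⊗ e) , a ⊗ e ⊕ b ⊗ c

  -- Multiplying xy = 0 by the conjugate a - b√d of x gives N(x)·y = 0, with coordinates `Nc≡0` and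
  -- `Ne≡0`; and N(x) = 0 forces x = 0.
  integral′ : ∀ {x y} → x *′ y ≡ (0F , 0F) → x ≡ (0F , 0F) ⊎ y ≡ (0F , 0F)
  integral′ {a , b} {c , e} eq =
    [ inj₁ ∘ zero-norm , (λ c≡0 → [ inj₁ ∘ zero-norm , (λ e≡0 → inj₂ (cong₂ _,_ c≡0 e≡0)) ]′ (integral Ne≡0)) ]′
      (integral Nc≡0)
    where
    zero-norm : norm a b ≡ 0F → (a , b) ≡ (0F , 0F)
    zero-norm N≡0 = let a≡0 , b≡0 = norm≡0 a b N≡0 in cong₂ _,_ a≡0 b≡0
    open ≡-Reasoning
    u≡0 : a ⊗ c ⊕ d ⊗ (b ⊗ e) ≡ 0F
    u≡0 = cong proj₁ eq
    v≡0 : a ⊗ e ⊕ b ⊗ c ≡ 0F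
    v≡0 = cong proj₂ eq
    combination≡0 : ∀ s t {u v} → u ≡ 0F → v ≡ 0F → s ⊗ u ⊕ t ⊗ v ≡ 0F
    combination≡0 s t refl refl = trans (cong₂ _⊕_ (zeroʳ s) (zeroʳ t)) (⊕-identityʳ 0F)
    Nc≡0 : norm a b ⊗ c ≡ 0F
    Nc≡0 = begin
      norm a b ⊗ c
        ≡⟨ vanish _ _ ⟨
      norm a b ⊗ c ⊕ (1F ⊕ n) ⊗ (a ⊗ d ⊗ b ⊗ e)
        ≡⟨ solve 6 (λ a b c e d n →
             (a :* a :+ n :* (d :* (b :* b))) :* c :+ (con 1 :+ n) :* (a :* d :* b :* e) :=
             a :* (a :* c :+ d :* (b :* e)) :+ n :* d :* b :* (a :* e :+ b :* c)) refl a b c e d n ⟩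
      a ⊗ (a ⊗ c ⊕ d ⊗ (b ⊗ e)) ⊕ n ⊗ d ⊗ b ⊗ (a ⊗ e ⊕ b ⊗ c)
        ≡⟨ combination≡0 a (n ⊗ d ⊗ b) u≡0 v≡0 ⟩
      0F ∎
    Ne≡0 : norm a b ⊗ e ≡ 0F
    Ne≡0 = begin
      norm a b ⊗ e
        ≡⟨ vanish _ _ ⟨
      norm a b ⊗ e ⊕ (1F ⊕ n) ⊗ (a ⊗ b ⊗ c)
        ≡⟨ solve 6 (λ a b c e d n →
             (a :* a :+ n :* (d :* (b :* b))) :* e :+ (con 1 :+ n) :* (a :* b :* c) :=
             n :* b :* (a :* c :+ d :* (b :* e)) :+ a :* (a :* e :+ b :* c)) refl a b c e d n ⟩
      n ⊗ b ⊗ (a ⊗ c ⊕ d ⊗ (b ⊗ e)) ⊕ a ⊗ (a ⊗ e ⊕ b ⊗ c)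
        ≡⟨ combination≡0 (n ⊗ b) a u≡0 v≡0 ⟩
      0F ∎
  -- Taking norms in A² = √d·B² gives N(A)² = −d·N(B)² = d·(i·N(B))².
  nonsquare′ : ∀ {x y} → x *′ x ≡ (0F , 1F) *′ (y *′ y) → y ≡ (0F , 0F)
  nonsquare′ {a , b} {c , e} eq = let c≡0 , e≡0 = norm≡0 c e NB≡0 in cong₂ _,_ c≡0 e≡0
    where
    open ≡-Reasoning
    NA NB u v : K
    NA = norm a b
    NB = norm c e
    u = c ⊗ c ⊕ d ⊗ (e ⊗ e)
    v = c ⊗ e ⊕ e ⊗ c
    -- With (u , v) = B², the hypothesis is A² = d v + u√d; `eq₁` and `eq₂` are its coordinates.
    eq₁ : a ⊗ a ⊕ d ⊗ (b ⊗ b) ≡ d ⊗ v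
    eq₁ = trans (cong proj₁ eq) (solve 3 (λ d u v → con 0 :* u :+ d :* (con 1 :* v) := d :* v) refl d u v)
    eq₂ : a ⊗ b ⊕ b ⊗ a ≡ u
    eq₂ = trans (cong proj₂ eq) (solve 2 (λ u v → con 0 :* v :+ con 1 :* u := u) refl u v)
    n²z : ∀ z → n ⊗ n ⊗ z ≡ z
    n²z z = trans (cong (_⊗ z) n²≡1) (⊗-identityˡ z)
    w x y z : K
    w = d ⊗ d ⊗ (b ⊗ b ⊗ (b ⊗ b))
    x = d ⊗ (a ⊗ b ⊗ (a ⊗ b))
    y = d ⊗ d ⊗ (c ⊗ e ⊗ (c ⊗ e))
    z = n ⊗ d ⊗ d ⊗ d ⊗ (e ⊗ e ⊗ (e ⊗ e))
    -- The chain is N(A)² = N(A²) = (d v)² - d u² = -d N(B²) = -d N(B)².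
    norms : NA ⊗ NA ≡ d ⊗ (i ⊗ NB ⊗ (i ⊗ NB))
    norms = begin
      NA ⊗ NA
        ≡⟨ solve 4 (λ a b d n →
             (a :* a :+ n :* (d :* (b :* b))) :* (a :* a :+ n :* (d :* (b :* b))) :=
             a :* a :* (a :* a) :+ (n :* (d :* (a :* b :* (a :* b))) :+ n :* (d :* (a :* b :* (a :* b))))
               :+ n :* n :* (d :* d :* (b :* b :* (b :* b)))) refl a b d n ⟩
      a ⊗ a ⊗ (a ⊗ a) ⊕ (n ⊗ x ⊕ n ⊗ x) ⊕ n ⊗ n ⊗ w
        ≡⟨ cong (a ⊗ a ⊗ (a ⊗ a) ⊕ (n ⊗ x ⊕ n ⊗ x) ⊕_) (n²z w) ⟩
      a ⊗ a ⊗ (a ⊗ a) ⊕ (n ⊗ x ⊕ n ⊗ x) ⊕ w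
        ≡⟨ vanish _ (x ⊕ x) ⟨
      a ⊗ a ⊗ (a ⊗ a) ⊕ (n ⊗ x ⊕ n ⊗ x) ⊕ w ⊕ (1F ⊕ n) ⊗ (x ⊕ x)
        ≡⟨ solve 4 (λ a b d n → let x = d :* (a :* b :* (a :* b)) in
             a :* a :* (a :* a) :+ (n :* x :+ n :* x) :+ d :* d :* (b :* b :* (b :* b))
               :+ (con 1 :+ n) :* (x :+ x) :=
             (a :* a :+ d :* (b :* b)) :* (a :* a :+ d :* (b :* b))
               :+ n :* d :* ((a :* b :+ b :* a) :* (a :* b :+ b :* a))) refl a b d n ⟩
      (a ⊗ a ⊕ d ⊗ (b ⊗ b)) ⊗ (a ⊗ a ⊕ d ⊗ (b ⊗ b)) ⊕ n ⊗ d ⊗ ((a ⊗ b ⊕ b ⊗ a) ⊗ (a ⊗ b ⊕ b ⊗ a))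
        ≡⟨ cong₂ (λ s t → s ⊗ s ⊕ n ⊗ d ⊗ (t ⊗ t)) eq₁ eq₂ ⟩
      d ⊗ v ⊗ (d ⊗ v) ⊕ n ⊗ d ⊗ (u ⊗ u)
        ≡⟨ solve 4 (λ c e d n → let y = d :* d :* (c :* e :* (c :* e)) in
             d :* (c :* e :+ e :* c) :* (d :* (c :* e :+ e :* c))
               :+ n :* d :* ((c :* c :+ d :* (e :* e)) :* (c :* c :+ d :* (e :* e))) :=
             n :* d :* (c :* c :* (c :* c)) :+ (y :+ y)
               :+ n :* d :* d :* d :* (e :* e :* (e :* e)) :+ (con 1 :+ n) :* (y :+ y)) refl c e d n ⟩
      n ⊗ d ⊗ (c ⊗ c ⊗ (c ⊗ c)) ⊕ (y ⊕ y) ⊕ z ⊕ (1F ⊕ n) ⊗ (y ⊕ y)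
        ≡⟨ vanish _ (y ⊕ y) ⟩
      n ⊗ d ⊗ (c ⊗ c ⊗ (c ⊗ c)) ⊕ (y ⊕ y) ⊕ z
        ≡⟨ cong₂ (λ s t → n ⊗ d ⊗ (c ⊗ c ⊗ (c ⊗ c)) ⊕ s ⊕ t) (n²z (y ⊕ y)) (n²z z) ⟨
      n ⊗ d ⊗ (c ⊗ c ⊗ (c ⊗ c)) ⊕ n ⊗ n ⊗ (y ⊕ y) ⊕ n ⊗ n ⊗ z
        ≡⟨ solve 4 (λ c e d i → let n = i :* i ; y = d :* d :* (c :* e :* (c :* e)) in
             n :* d :* (c :* c :* (c :* c)) :+ n :* n :* (y :+ y)
               :+ n :* n :* (n :* d :* d :* d :* (e :* e :* (e :* e))) :=
             d :* (i :* (c :* c :+ n :* (d :* (e :* e))) :* (i :* (c :* c :+ n :* (d :* (e :* e))))))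
             refl c e d i ⟩
      d ⊗ (i ⊗ NB ⊗ (i ⊗ NB)) ∎
    -- As i⁴ = n² = 1, multiplying i·N(B) = 0 by i³ recovers N(B).
    NB≡0 : NB ≡ 0F
    NB≡0 = begin
      NB                     ≡⟨ n²z NB ⟨
      n ⊗ n ⊗ NB             ≡⟨ solve 2 (λ i N → i :* i :* (i :* i) :* N := i :* i :* i :* (i :* N)) refl i NB ⟩
      i ⊗ i ⊗ i ⊗ (i ⊗ NB)   ≡⟨ cong (i ⊗ i ⊗ i ⊗_) (nonsquare norms) ⟩
      i ⊗ i ⊗ i ⊗ 0F         ≡⟨ zeroʳ _ ⟩
      0F                     ∎

  isCommutativeSemiring′ : IsCommutativeSemiring _≡_ _+′_ _*′_ (0F , 0F) (1F , 0F)
  isCommutativeSemiring′ = isCommutativeSemiringˡ record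
    { +-isCommutativeMonoid = record
      { isMonoid = record
        { isSemigroup = record
          { isMagma = record { isEquivalence = isEquivalence ; ∙-cong = cong₂ _+′_ }
          ; assoc = λ { (a , b) (c , e) (f , g) → cong₂ _,_ (+-assoc′ a c f) (+-assoc′ b e g) } }
        ; identity = (λ { (a , b) → cong₂ _,_ (⊕-identityˡ a) (⊕-identityˡ b) })
                   , (λ { (a , b) → cong₂ _,_ (⊕-identityʳ a) (⊕-identityʳ b) }) }
      ; comm = λ { (a , b) (c , e) → cong₂ _,_ (⊕-comm a c) (⊕-comm b e) } }
    ; *-isCommutativeMonoid = record
      { isMonoid = record
        { isSemigroup = record
          { isMagma = record { isEquivalence = isEquivalence ; ∙-cong = cong₂ _*′_ }
          ; assoc = λ { (a , b) (c , e) (f , g) → cong₂ _,_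
              (solve 7 (λ d a b c e f g →
                (a :* c :+ d :* (b :* e)) :* f :+ d :* ((a :* e :+ b :* c) :* g) :=
                a :* (c :* f :+ d :* (e :* g)) :+ d :* (b :* (c :* g :+ e :* f))) refl d a b c e f g)
              (solve 7 (λ d a b c e f g →
                (a :* c :+ d :* (b :* e)) :* g :+ (a :* e :+ b :* c) :* f :=
                a :* (c :* g :+ e :* f) :+ b :* (c :* f :+ d :* (e :* g))) refl d a b c e f g) } }
        ; identity = identityˡ′ , λ x → trans (*-comm′ x _) (identityˡ′ x) }
      ; comm = *-comm′ }
    ; distribʳ = λ { (a , b) (c , e) (f , g) → cong₂ _,_
        (solve 7 (λ d a b c e f g →
          (c :+ f) :* a :+ d :* ((e :+ g) :* b) :=
          c :* a :+ d :* (e :* b) :+ (f :* a :+ d :* (g :* b))) refl d a b c e f g)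
        (solve 6 (λ a b c e f g →
          (c :+ f) :* b :+ (e :+ g) :* a := c :* b :+ e :* a :+ (f :* b :+ g :* a)) refl a b c e f g) }
    ; zeroˡ = λ { (a , b) → cong₂ _,_
        (solve 3 (λ d a b → con 0 :* a :+ d :* (con 0 :* b) := con 0) refl d a b)
        (solve 2 (λ a b → con 0 :* b :+ con 0 :* a := con 0) refl a b) }
    }
    where
    +-assoc′ : ∀ a b c → a ⊕ b ⊕ c ≡ a ⊕ (b ⊕ c)
    +-assoc′ = solve 3 (λ a b c → a :+ b :+ c := a :+ (b :+ c)) refl
    *-comm′ : ∀ x y → x *′ y ≡ y *′ x
    *-comm′ (a , b) (c , e) = cong₂ _,_
      (solve 5 (λ d a b c e → a :* c :+ d :* (b :* e) := c :* a :+ d :* (e :* b)) refl d a b c e)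
      (solve 4 (λ a b c e → a :* e :+ b :* c := c :* b :+ e :* a) refl a b c e)
    identityˡ′ : ∀ x → (1F , 0F) *′ x ≡ x
    identityˡ′ (a , b) = cong₂ _,_
      (solve 3 (λ d a b → con 1 :* a :+ d :* (con 0 :* b) := a) refl d a b)
      (solve 2 (λ a b → con 1 :* b :+ con 0 :* a := b) refl a b)

  adjoin-√d : FiniteDomain
  adjoin-√d = record
    { F = K × K
    ; _⊕_ = _+′_
    ; _⊗_ = _*′_
    ; 0F = 0F , 0F
    ; 1F = 1F , 0F
    ; i = i , 0F
    -- The new non-square is √d itself, by `nonsquare′`, so the construction can be iterated.
    ; d = 0F , 1F
    ; isCommutativeSemiring = isCommutativeSemiring′
    ; 1+i²≡0 = cong₂ _,_
        (trans (solve 2 (λ d i → con 1 :+ (i :* i :+ d :* (con 0 :* con 0)) := con 1 :+ i :* i) refl d i) 1+i²≡0)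
        (solve 1 (λ i → con 0 :+ (i :* con 0 :+ con 0 :* i) := con 0) refl i)
    ; integral = integral′
    ; nonsquare = nonsquare′
    ; _≟_ = ≡-dec _≟_ _≟_
    ; els = cartesianProduct els els
    ; complete = λ { (a , b) → ∈-cartesianProduct⁺ (complete a) (complete b) }
    ; unique = cartesianProduct⁺ unique unique
    }

open Tower using (adjoin-√d)

-- Modulo 5, 2² = -1 and the squares are 0, 1, 4, so 2 serves both as `i` and as `d`. The laws are
-- decided by exhaustive search.
𝔽₅ : FiniteDomain
𝔽₅ = record
  { F = Fin 5
  ; _⊕_ = _⊕_
  ; _⊗_ = _⊗_
  ; 0F = Fin.0F
  ; 1F = Fin.1F
  ; i = Fin.2F
  ; d = Fin.2F
  ; isCommutativeSemiring = isCommutativeSemiringˡ record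
    { +-isCommutativeMonoid = record
      { isMonoid = record
        { isSemigroup = record
          { isMagma = record { isEquivalence = isEquivalence ; ∙-cong = cong₂ _⊕_ }
          ; assoc = from-yes (Fin.all? λ a → Fin.all? λ b → Fin.all? λ c → ((a ⊕ b) ⊕ c) Fin.≟ (a ⊕ (b ⊕ c))) }
        ; identity = from-yes (Fin.all? λ a → (Fin.0F ⊕ a) Fin.≟ a) , from-yes (Fin.all? λ a → (a ⊕ Fin.0F) Fin.≟ a) }
      ; comm = from-yes (Fin.all? λ a → Fin.all? λ b → (a ⊕ b) Fin.≟ (b ⊕ a)) }
    ; *-isCommutativeMonoid = record
      { isMonoid = record
        { isSemigroup = record
          { isMagma = record { isEquivalence = isEquivalence ; ∙-cong = cong₂ _⊗_ }
          ; assoc = from-yes (Fin.all? λ a → Fin.all? λ b → Fin.all? λ c → ((a ⊗ b) ⊗ c) Fin.≟ (a ⊗ (b ⊗ c))) }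
        ; identity = from-yes (Fin.all? λ a → (Fin.1F ⊗ a) Fin.≟ a) , from-yes (Fin.all? λ a → (a ⊗ Fin.1F) Fin.≟ a) }
      ; comm = from-yes (Fin.all? λ a → Fin.all? λ b → (a ⊗ b) Fin.≟ (b ⊗ a)) }
    ; distribʳ = from-yes (Fin.all? λ a → Fin.all? λ b → Fin.all? λ c → ((b ⊕ c) ⊗ a) Fin.≟ ((b ⊗ a) ⊕ (c ⊗ a)))
    ; zeroˡ = from-yes (Fin.all? λ a → (Fin.0F ⊗ a) Fin.≟ Fin.0F)
    }
  ; 1+i²≡0 = refl
  ; integral = λ {x} {y} → from-yes (Fin.all? λ x → Fin.all? λ y →
      ((x ⊗ y) Fin.≟ Fin.0F) →-dec ((x Fin.≟ Fin.0F) ⊎-dec (y Fin.≟ Fin.0F))) x y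
  ; nonsquare = λ {a} {b} → from-yes (Fin.all? λ a → Fin.all? λ b →
      ((a ⊗ a) Fin.≟ (Fin.2F ⊗ (b ⊗ b))) →-dec (b Fin.≟ Fin.0F)) a b
  ; _≟_ = Fin._≟_
  ; els = allFin 5
  ; complete = ∈-allFin
  ; unique = allFin⁺ 5
  }
  where
  _⊕_ _⊗_ : Fin 5 → Fin 5 → Fin 5
  a ⊕ b = (toℕ a + toℕ b) mod 5
  a ⊗ b = (toℕ a * toℕ b) mod 5

-- The order of `𝔽 j` is 625^(2^j). Among 5, 25, 625, ... the first value to exceed 100 is 625, and
-- `qⁿ≤N⁶` relies on 100 ≤ q.
𝔽 : ℕ → FiniteDomain
𝔽 zero    = adjoin-√d (adjoin-√d 𝔽₅)
𝔽 (suc j) = adjoin-√d (𝔽 j)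

order-𝔽 : ℕ → ℕ
order-𝔽 j = FiniteDomain.order (𝔽 j)

order-𝔽-zero : order-𝔽 0 ≡ 625
order-𝔽-zero = refl

order-𝔽-suc : ∀ j → order-𝔽 (suc j) ≡ order-𝔽 j * order-𝔽 j
order-𝔽-suc j = length-product _,_ (FiniteDomain.els (𝔽 j)) (FiniteDomain.els (𝔽 j))

open +-*-Solver using (solve; _:=_; _:+_; _:*_; _:^_; con)

-- Edges between sets of flags

2ab≤a²+b² : ∀ a b → 2 * (a * b) ≤ a * a + b * b
2ab≤a²+b² a b = [ ordered a b , swapped ]′ (≤-total a b)
  where
  ordered : ∀ a b → a ≤ b → 2 * (a * b) ≤ a * a + b * b
  ordered a b a≤b with k , refl ← m≤n⇒∃[o]m+o≡n a≤b = begin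
    2 * (a * (a + k))              ≤⟨ m≤m+n _ (k * k) ⟩
    2 * (a * (a + k)) + k * k      ≡⟨ solve 2 (λ a k →
      con 2 :* (a :* (a :+ k)) :+ k :* k := a :* a :+ (a :+ k) :* (a :+ k)) refl a k ⟩
    a * a + (a + k) * (a + k)      ∎
    where open ≤-Reasoning
  swapped : b ≤ a → 2 * (a * b) ≤ a * a + b * b
  swapped b≤a = subst₂ _≤_ (cong (2 *_) (*-comm b a)) (+-comm (b * b) (a * a)) (ordered b a b≤a)

-- S = supp σ and T = supp τ span no edge from S to T.  Compare the number N b of edges from b into T
-- with its typical value |T|/q by summing (q·N b − |T|)² over all b: each b ∈ S contributes |T|².
hole-bound : {V : Set} (vs : List V) (D E : V → V → ℕ) (σ τ : V → ℕ) (r : ℕ) → let q = suc r in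
  length vs ≡ q * (q * q) →
  (∀ c → ∑ vs (λ b → D b c) ≡ r * r) →
  (∀ c c′ → ∑ vs (λ b → D b c * D b c′) ≤ q * (1 + q * E c c′)) →
  (∀ c → ∑ vs (E c) ≤ q) →
  (∀ c → τ c ≤ 1) →
  (∀ b → σ b ≡ 0 ⊎ (σ b ≤ 1 × (∀ c → τ c * D b c ≡ 0))) →
  ∑ vs σ * ∑ vs τ ≤ 5 * q ^ 5
hole-bound {V} vs D E σ τ r size indegree codegree E-degree τ≤1 hole = conclude T refl
  where
  q S T : ℕ
  q = suc r
  S = ∑ vs σ
  T = ∑ vs τ
  N : V → ℕ
  N b = ∑ vs (λ c → τ c * D b c)

  -- Subtraction-free form of (q·N b - T)² ≥ T²·σ b. Where σ vanishes, a square is non-negative;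
  -- elsewhere N b = 0.
  pointwise : ∀ b → 2 * q * T * N b + T * T * σ b ≤ q * q * (N b * N b) + T * T
  pointwise b with hole b
  ... | inj₁ σ≡0 = begin
    2 * q * T * N b + T * T * σ b   ≡⟨ cong (λ s → 2 * q * T * N b + T * T * s) σ≡0 ⟩
    2 * q * T * N b + T * T * 0     ≡⟨ solve 3 (λ q T N →
      con 2 :* q :* T :* N :+ T :* T :* con 0 := con 2 :* (q :* N :* T)) refl q T (N b) ⟩
    2 * (q * N b * T)               ≤⟨ 2ab≤a²+b² (q * N b) T ⟩
    q * N b * (q * N b) + T * T     ≡⟨ solve 3 (λ q T N →
      q :* N :* (q :* N) :+ T :* T := q :* q :* (N :* N) :+ T :* T) refl q T (N b) ⟩
    q * q * (N b * N b) + T * T     ∎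
    where open ≤-Reasoning
  ... | inj₂ (σ≤1 , no-edge) = begin
    2 * q * T * N b + T * T * σ b   ≡⟨ cong (λ s → 2 * q * T * s + T * T * σ b) (∑-≡0 vs _ (λ {c} _ → no-edge c)) ⟩
    2 * q * T * 0 + T * T * σ b     ≡⟨ cong (_+ T * T * σ b) (*-zeroʳ (2 * q * T)) ⟩
    T * T * σ b                     ≤⟨ *-monoʳ-≤ (T * T) σ≤1 ⟩
    T * T * 1                       ≡⟨ *-identityʳ (T * T) ⟩
    T * T                           ≤⟨ m≤n+m _ _ ⟩
    q * q * (N b * N b) + T * T     ∎
    where open ≤-Reasoning

  ∑N : ∑ vs N ≡ T * (r * r)
  ∑N = begin
    ∑ vs (λ b → ∑ vs (λ c → τ c * D b c))   ≡⟨ ∑-swap vs vs _ ⟩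
    ∑ vs (λ c → ∑ vs (λ b → τ c * D b c))   ≡⟨ ∑-cong vs (λ c → trans (∑-*ˡ vs (τ c) _) (cong (τ c *_) (indegree c))) ⟩
    ∑ vs (λ c → τ c * (r * r))              ≡⟨ ∑-*ʳ vs τ (r * r) ⟩
    T * (r * r)                             ∎
    where open ≡-Reasoning

  -- Expanding the square and summing over b first leaves the codegrees of pairs c, c′; the excess
  -- at pairs related by `E` is controlled by `E-degree`.
  ∑N² : ∑ vs (λ b → N b * N b) ≤ T * (q * (T + q * q))
  ∑N² = begin
    ∑ vs (λ b → N b * N b)
      ≡⟨ ∑-cong vs (λ b → sym (trans (∑-cong vs (λ c → ∑-*ˡ vs (τ c * D b c) _)) (∑-*ʳ vs _ (N b)))) ⟩
    ∑ vs (λ b → ∑ vs (λ c → ∑ vs (λ c′ → τ c * D b c * (τ c′ * D b c′))))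
      ≡⟨ ∑-swap vs vs _ ⟩
    ∑ vs (λ c → ∑ vs (λ b → ∑ vs (λ c′ → τ c * D b c * (τ c′ * D b c′))))
      ≡⟨ ∑-cong vs (λ c → ∑-swap vs vs _) ⟩
    ∑ vs (λ c → ∑ vs (λ c′ → ∑ vs (λ b → τ c * D b c * (τ c′ * D b c′))))
      ≤⟨ ∑-mono vs (λ c → ∑-mono vs (λ c′ → pair c c′)) ⟩
    ∑ vs (λ c → ∑ vs (λ c′ → τ c * (q * (τ c′ + q * E c c′))))
      ≡⟨ ∑-cong vs (λ c → trans (∑-*ˡ vs (τ c) _) (cong (τ c *_) (trans (∑-*ˡ vs q _)
           (cong (q *_) (trans (∑-+ vs τ _) (cong (T +_) (∑-*ˡ vs q (E c)))))))) ⟩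
    ∑ vs (λ c → τ c * (q * (T + q * ∑ vs (E c))))
      ≤⟨ ∑-mono vs (λ c → *-monoʳ-≤ (τ c) (*-monoʳ-≤ q (+-monoʳ-≤ T (*-monoʳ-≤ q (E-degree c))))) ⟩
    ∑ vs (λ c → τ c * (q * (T + q * q)))
      ≡⟨ ∑-*ʳ vs τ _ ⟩
    T * (q * (T + q * q)) ∎
    where
    open ≤-Reasoning
    pair : ∀ c c′ → ∑ vs (λ b → τ c * D b c * (τ c′ * D b c′)) ≤ τ c * (q * (τ c′ + q * E c c′))
    pair c c′ = begin
      ∑ vs (λ b → τ c * D b c * (τ c′ * D b c′))
        ≡⟨ ∑-cong vs (λ b → solve 4 (λ t d t′ d′ → t :* d :* (t′ :* d′) := t :* t′ :* (d :* d′)) refl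
             (τ c) (D b c) (τ c′) (D b c′)) ⟩
      ∑ vs (λ b → τ c * τ c′ * (D b c * D b c′))
        ≡⟨ ∑-*ˡ vs (τ c * τ c′) _ ⟩
      τ c * τ c′ * ∑ vs (λ b → D b c * D b c′)
        ≤⟨ *-monoʳ-≤ (τ c * τ c′) (codegree c c′) ⟩
      τ c * τ c′ * (q * (1 + q * E c c′))
        ≡⟨ solve 4 (λ t t′ q e → t :* t′ :* (q :* (con 1 :+ q :* e)) := t :* (q :* (t′ :+ t′ :* (q :* e)))) refl
             (τ c) (τ c′) q (E c c′) ⟩
      τ c * (q * (τ c′ + τ c′ * (q * E c c′)))
        ≤⟨ *-monoʳ-≤ (τ c) (*-monoʳ-≤ q (+-monoʳ-≤ (τ c′) (*-monoˡ-≤ (q * E c c′) (τ≤1 c′)))) ⟩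
      τ c * (q * (τ c′ + 1 * (q * E c c′)))
        ≡⟨ cong (λ z → τ c * (q * (τ c′ + z))) (*-identityˡ _) ⟩
      τ c * (q * (τ c′ + q * E c c′)) ∎

  T≤q³ : T ≤ q * (q * q)
  T≤q³ = ≤-trans (∑-mono vs τ≤1) (≤-reflexive (trans (∑-one vs) size))

  second-moment : T * (2 * q * T * (r * r) + T * S) ≤ T * (2 * (q * q * q) * T + q ^ 5)
  second-moment = begin
    T * (2 * q * T * (r * r) + T * S)
      ≡⟨ solve 4 (λ q T r S → T :* (con 2 :* q :* T :* (r :* r) :+ T :* S) :=
           con 2 :* q :* T :* (T :* (r :* r)) :+ T :* T :* S) refl q T r S ⟩
    2 * q * T * (T * (r * r)) + T * T * S
      ≡⟨ cong (λ z → 2 * q * T * z + T * T * S) ∑N ⟨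
    2 * q * T * ∑ vs N + T * T * S
      ≡⟨ trans (∑-+ vs _ _) (cong₂ _+_ (∑-*ˡ vs (2 * q * T) N) (∑-*ˡ vs (T * T) σ)) ⟨
    ∑ vs (λ b → 2 * q * T * N b + T * T * σ b)
      ≤⟨ ∑-mono vs pointwise ⟩
    ∑ vs (λ b → q * q * (N b * N b) + T * T)
      ≡⟨ trans (∑-+ vs _ _) (cong₂ _+_ (∑-*ˡ vs (q * q) _) (trans (∑-const vs (T * T)) (cong (_* (T * T)) size))) ⟩
    q * q * ∑ vs (λ b → N b * N b) + q * (q * q) * (T * T)
      ≤⟨ +-monoˡ-≤ _ (*-monoʳ-≤ (q * q) ∑N²) ⟩
    q * q * (T * (q * (T + q * q))) + q * (q * q) * (T * T)
      ≡⟨ solve 2 (λ q T → q :* q :* (T :* (q :* (T :+ q :* q))) :+ q :* (q :* q) :* (T :* T) :=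
           T :* (con 2 :* (q :* q :* q) :* T :+ q :^ 5)) refl q T ⟩
    T * (2 * (q * q * q) * T + q ^ 5) ∎
    where open ≤-Reasoning

  -- The common factor T of `second-moment` can be cancelled only if T ≠ 0; for T = 0 the bound is
  -- trivial.
  conclude : ∀ t → T ≡ t → S * T ≤ 5 * q ^ 5
  conclude zero    T≡0 = ≤-trans (≤-reflexive (trans (cong (S *_) T≡0) (*-zeroʳ S))) z≤n
  conclude (suc t) T≡t = +-cancelˡ-≤ (2 * q * T * (r * r)) _ _ (begin
    2 * q * T * (r * r) + S * T
      ≡⟨ cong (2 * q * T * (r * r) +_) (*-comm S T) ⟩
    2 * q * T * (r * r) + T * S
      ≤⟨ *-cancelˡ-≤ T {{subst NonZero (sym T≡t) _}} second-moment ⟩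
    2 * (q * q * q) * T + q ^ 5
      -- Since q² - r² = 2q - 1, the terms 2q³T and 2qTr² differ by 4q²T - 2qT. Adding 2qT removes
      -- the subtraction, and 4q²T ≤ 4q⁵ then yields the constant 5.
      ≤⟨ m≤m+n _ (2 * q * T) ⟩
    2 * (q * q * q) * T + q ^ 5 + 2 * q * T
      ≡⟨ solve 2 (λ r T → let q = con 1 :+ r in
           con 2 :* (q :* q :* q) :* T :+ q :^ 5 :+ con 2 :* q :* T :=
           con 2 :* q :* T :* (r :* r) :+ (con 4 :* (q :* q) :* T :+ q :^ 5)) refl r T ⟩
    2 * q * T * (r * r) + (4 * (q * q) * T + q ^ 5)
      ≤⟨ +-monoʳ-≤ (2 * q * T * (r * r)) (+-monoˡ-≤ (q ^ 5) (*-monoʳ-≤ (4 * (q * q)) T≤q³)) ⟩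
    2 * q * T * (r * r) + (4 * (q * q) * (q * (q * q)) + q ^ 5)
      ≡⟨ cong (2 * q * T * (r * r) +_)
           (solve 1 (λ q → con 4 :* (q :* q) :* (q :* (q :* q)) :+ q :^ 5 := con 5 :* q :^ 5) refl q) ⟩
    2 * q * T * (r * r) + 5 * q ^ 5 ∎)
    where open ≤-Reasoning

-- The flags of an affine plane: (x , m , k) is the point with abscissa x on the line y = m x + k.
-- There is an edge b → c when the point of b lies on the line of c, and b, c share neither point nor line.
module Flags (R : FiniteDomain) where
  open FiniteDomain R renaming (F to K) hiding (solve; _:=_; _:+_; _:*_; con)

  Flag : Set
  Flag = K × K × K

  flags : List Flag
  flags = cartesianProduct els (cartesianProduct els els)

  ∈-flags : ∀ b → b ∈ flags
  ∈-flags (x , m , k) = ∈-cartesianProduct⁺ (complete x) (∈-cartesianProduct⁺ (complete m) (complete k))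

  length-flags : length flags ≡ order * (order * order)
  length-flags = trans (length-product _,_ els _) (cong (order *_) (length-product _,_ els els))

  _≟ᶠ_ : DecidableEquality Flag
  _≟ᶠ_ = ≡-dec _≟_ (≡-dec _≟_ _≟_)

  height : Flag → K → K
  height (_ , m , k) x = m ⊗ x ⊕ k

  _⇝_ : Flag → Flag → Set
  b@(x , m , _) ⇝ c@(x′ , m′ , _) = x ≢ x′ × m ≢ m′ × height b x ≡ height c x

  _⇝?_ : ∀ b c → Dec (b ⇝ c)
  b@(x , m , _) ⇝? c@(x′ , m′ , _) = ¬? (x ≟ x′) ×-dec (¬? (m ≟ m′) ×-dec (height b x ≟ height c x))

  -- The points of b and c are distinct and lie on both the line of c and the line of e, so these
  -- lines have equal slopes, against c ⇝ e.
  no-transitive-triangle : ∀ {b c e} → b ⇝ c → c ⇝ e → b ⇝ e → ⊥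
  no-transitive-triangle (x≢ , _ , on-c) (_ , m≢ , c-on-e) (_ , _ , on-e) =
    m≢ (proj₁ (lines-meet-once (trans (sym on-c) on-e) c-on-e x≢))

  ∑-flags : (f : Flag → ℕ) → ∑ flags f ≡ ∑ els (λ x → ∑ els (λ m → ∑ els (λ k → f (x , m , k))))
  ∑-flags f = trans (∑-product _,_ els _ f) (∑-cong els (λ x → ∑-product _,_ els els (λ mk → f (x , mk))))

  -- The solution is k = w - z. Geometrically, one line of each slope passes through a given point.
  ∑-point : ∀ z w → ∑ els (λ k → ⟦ z ⊕ k ≟ w ⟧) ≡ 1
  ∑-point z w = trans
    (∑-cong els (λ k → ⟦⟧-cong (z ⊕ k ≟ w) (k ≟ w-z) (solution k) (λ { refl → ⊕-solution z w })))
    (∑-δ₁ _≟_ unique (complete w-z))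
    where
    w-z : K
    w-z = w ⊕ n ⊗ z
    solution : ∀ k → z ⊕ k ≡ w → k ≡ w-z
    solution k eq = ⊕-cancelʳ z (trans (⊕-comm k z) (trans eq (trans (sym (⊕-solution z w)) (⊕-comm z w-z))))

  ∑-≢ : ∀ {r} → order ≡ suc r → ∀ y → ∑ els (λ x → ⟦ ¬? (x ≟ y) ⟧) ≡ r
  ∑-≢ {r} order≡ y = +-cancelʳ-≡ 1 _ _ (begin
    ∑ els (λ x → ⟦ ¬? (x ≟ y) ⟧) + 1                             ≡⟨ cong (∑ els (λ x → ⟦ ¬? (x ≟ y) ⟧) +_) (∑-δ₁ _≟_ unique (complete y)) ⟨
    ∑ els (λ x → ⟦ ¬? (x ≟ y) ⟧) + ∑ els (λ x → ⟦ x ≟ y ⟧)       ≡⟨ ∑-+ els _ _ ⟨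
    ∑ els (λ x → ⟦ ¬? (x ≟ y) ⟧ + ⟦ x ≟ y ⟧)                     ≡⟨ ∑-cong els (λ x → ⟦⟧-¬ (x ≟ y)) ⟩
    ∑ els (λ _ → 1)                                              ≡⟨ ∑-one els ⟩
    order                                                        ≡⟨ trans order≡ (sym (+-comm r 1)) ⟩
    r + 1                                                        ∎)
    where open ≡-Reasoning

  -- There are r choices for x and r for m; x fixes the point of b on the line of c, and this point
  -- with m fixes k.
  indegree : ∀ {r} → order ≡ suc r → ∀ c → ∑ flags (λ b → ⟦ b ⇝? c ⟧) ≡ r * r
  indegree {r} order≡ c@(x′ , m′ , _) = begin
    ∑ flags (λ b → ⟦ b ⇝? c ⟧)
      ≡⟨ ∑-flags _ ⟩
    ∑ els (λ x → ∑ els (λ m → ∑ els (λ k → ⟦ (x , m , k) ⇝? c ⟧)))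
      ≡⟨ ∑-cong els (λ x → ∑-cong els (λ m → ∑-cong els (λ k →
           trans (⟦⟧-× (¬? (x ≟ x′)) (¬? (m ≟ m′) ×-dec (m ⊗ x ⊕ k ≟ height c x)))
             (cong (⟦ ¬? (x ≟ x′) ⟧ *_) (⟦⟧-× (¬? (m ≟ m′)) (m ⊗ x ⊕ k ≟ height c x)))))) ⟩
    ∑ els (λ x → ∑ els (λ m → ∑ els (λ k → ⟦ ¬? (x ≟ x′) ⟧ * (⟦ ¬? (m ≟ m′) ⟧ * ⟦ m ⊗ x ⊕ k ≟ height c x ⟧))))
      ≡⟨ ∑-cong els (λ x → ∑-cong els (λ m → trans (∑-*ˡ els ⟦ ¬? (x ≟ x′) ⟧ _) (cong (⟦ ¬? (x ≟ x′) ⟧ *_)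
           (trans (∑-*ˡ els ⟦ ¬? (m ≟ m′) ⟧ _) (trans
             (cong (⟦ ¬? (m ≟ m′) ⟧ *_) (∑-point (m ⊗ x) (height c x))) (*-identityʳ _)))))) ⟩
    ∑ els (λ x → ∑ els (λ m → ⟦ ¬? (x ≟ x′) ⟧ * ⟦ ¬? (m ≟ m′) ⟧))
      ≡⟨ ∑-cong els (λ x → trans (∑-*ˡ els ⟦ ¬? (x ≟ x′) ⟧ _) (cong (⟦ ¬? (x ≟ x′) ⟧ *_) (∑-≢ order≡ m′))) ⟩
    ∑ els (λ x → ⟦ ¬? (x ≟ x′) ⟧ * r)
      ≡⟨ trans (∑-*ʳ els _ r) (cong (_* r) (∑-≢ order≡ x′)) ⟩
    r * r ∎
    where open ≡-Reasoning

  -- This is the `E` of `hole-bound`, marking the pairs whose codegree may be exceptionally large.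
  same-line : Flag → Flag → ℕ
  same-line (_ , m , k) (_ , m′ , k′) = ⟦ m′ ≟ m ⟧ * ⟦ k′ ≟ k ⟧

  ∑-same-line : ∀ c → ∑ flags (same-line c) ≡ order
  ∑-same-line c@(_ , m , k) = begin
    ∑ flags (same-line c)
      ≡⟨ ∑-flags _ ⟩
    ∑ els (λ _ → ∑ els (λ m′ → ∑ els (λ k′ → ⟦ m′ ≟ m ⟧ * ⟦ k′ ≟ k ⟧)))
      ≡⟨ ∑-cong els (λ _ → ∑-cong els (λ m′ →
           trans (∑-*ˡ els ⟦ m′ ≟ m ⟧ _) (cong (⟦ m′ ≟ m ⟧ *_) (∑-δ₁ _≟_ unique (complete k))))) ⟩
    ∑ els (λ _ → ∑ els (λ m′ → ⟦ m′ ≟ m ⟧ * 1))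
      ≡⟨ ∑-cong els (λ _ → ∑-δ _≟_ unique (complete m) (λ _ → 1)) ⟩
    ∑ els (λ _ → 1)
      ≡⟨ ∑-one els ⟩
    order ∎
    where open ≡-Reasoning

  -- Distinct lines agree in at most one abscissa, equal lines in all `order` of them.
  ∑-meet : ∀ c c′ → ∑ els (λ x → ⟦ height c x ≟ height c′ x ⟧) ≤ 1 + order * same-line c c′
  ∑-meet c@(_ , m , k) c′@(_ , m′ , k′) with m′ ≟ m | k′ ≟ k
  ... | yes _ | yes _ = begin
    ∑ els (λ x → ⟦ height c x ≟ height c′ x ⟧)   ≤⟨ ∑-mono els (λ x → ⟦⟧≤1 (height c x ≟ height c′ x)) ⟩
    ∑ els (λ _ → 1)                              ≡⟨ ∑-const els 1 ⟩
    order * 1                                    ≤⟨ n≤1+n _ ⟩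
    1 + order * 1                                ∎
    where open ≤-Reasoning
  ... | yes _ | no k≢ = ≤-trans (∑-⟦⟧≤1 (λ x → height c x ≟ height c′ x) unique unique-meet) (m≤m+n 1 _)
    where
    unique-meet : ∀ {x y} → height c x ≡ height c′ x → height c y ≡ height c′ y → x ≡ y
    unique-meet {x} {y} eq eq′ with x ≟ y
    ... | yes x≡y = x≡y
    ... | no x≢y  = contradiction (sym (proj₂ (lines-meet-once eq eq′ x≢y))) k≢
  ... | no m≢ | _ = ≤-trans (∑-⟦⟧≤1 (λ x → height c x ≟ height c′ x) unique unique-meet) (m≤m+n 1 _)
    where
    unique-meet : ∀ {x y} → height c x ≡ height c′ x → height c y ≡ height c′ y → x ≡ y
    unique-meet {x} {y} eq eq′ with x ≟ y
    ... | yes x≡y = x≡y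
    ... | no x≢y  = contradiction (sym (proj₁ (lines-meet-once eq eq′ x≢y))) m≢

  -- The point of a common in-neighbour lies on both lines, and each common point carries one line
  -- of each of the `order` slopes.
  codegree : ∀ c c′ → ∑ flags (λ b → ⟦ b ⇝? c ⟧ * ⟦ b ⇝? c′ ⟧) ≤ order * (1 + order * same-line c c′)
  codegree c c′ = begin
    ∑ flags (λ b → ⟦ b ⇝? c ⟧ * ⟦ b ⇝? c′ ⟧)
      ≡⟨ ∑-flags _ ⟩
    ∑ els (λ x → ∑ els (λ m → ∑ els (λ k → ⟦ (x , m , k) ⇝? c ⟧ * ⟦ (x , m , k) ⇝? c′ ⟧)))
      ≤⟨ ∑-mono els (λ x → ∑-mono els (λ m → ∑-mono els (λ k → on-both x m k))) ⟩
    ∑ els (λ x → ∑ els (λ m → ∑ els (λ k → ⟦ m ⊗ x ⊕ k ≟ height c x ⟧ * meet x)))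
      ≡⟨ ∑-cong els (λ x → ∑-cong els (λ m →
           trans (∑-*ʳ els _ (meet x)) (trans (cong (_* meet x) (∑-point (m ⊗ x) (height c x))) (*-identityˡ _)))) ⟩
    ∑ els (λ x → ∑ els (λ _ → meet x))
      ≡⟨ ∑-cong els (λ x → ∑-const els (meet x)) ⟩
    ∑ els (λ x → order * meet x)
      ≡⟨ ∑-*ˡ els order meet ⟩
    order * ∑ els meet
      ≤⟨ *-monoʳ-≤ order (∑-meet c c′) ⟩
    order * (1 + order * same-line c c′) ∎
    where
    open ≤-Reasoning
    meet : K → ℕ
    meet x = ⟦ height c x ≟ height c′ x ⟧
    on-both : ∀ x m k → ⟦ (x , m , k) ⇝? c ⟧ * ⟦ (x , m , k) ⇝? c′ ⟧ ≤ ⟦ m ⊗ x ⊕ k ≟ height c x ⟧ * meet x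
    on-both x m k = subst₂ _≤_
      (⟦⟧-× ((x , m , k) ⇝? c) ((x , m , k) ⇝? c′))
      (⟦⟧-× (m ⊗ x ⊕ k ≟ height c x) (height c x ≟ height c′ x))
      (⟦⟧-mono (((x , m , k) ⇝? c) ×-dec ((x , m , k) ⇝? c′))
        ((m ⊗ x ⊕ k ≟ height c x) ×-dec (height c x ≟ height c′ x))
        (λ { ((_ , _ , on-c) , (_ , _ , on-c′)) → on-c , trans (sym on-c) on-c′ }))

  flags-hole-bound : .{{_ : NonZero order}} → (σ τ : Flag → ℕ) → (∀ c → τ c ≤ 1) →
    (∀ b → σ b ≡ 0 ⊎ (σ b ≤ 1 × (∀ c → τ c * ⟦ b ⇝? c ⟧ ≡ 0))) →
    ∑ flags σ * ∑ flags τ ≤ 5 * order ^ 5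
  flags-hole-bound σ τ τ≤1 hole = bound (pred order) (sym (suc-pred order))
    where
    bound : ∀ r → order ≡ suc r → ∑ flags σ * ∑ flags τ ≤ 5 * order ^ 5
    bound r order≡ = subst (λ q → ∑ flags σ * ∑ flags τ ≤ 5 * q ^ 5) (sym order≡)
      (hole-bound flags (λ b c → ⟦ b ⇝? c ⟧) same-line σ τ r
        (trans length-flags (cong (λ q → q * (q * q)) order≡))
        (indegree order≡)
        (λ c c′ → subst (λ q → ∑ flags (λ b → ⟦ b ⇝? c ⟧ * ⟦ b ⇝? c′ ⟧) ≤ q * (1 + q * same-line c c′))
          order≡ (codegree c c′))
        (λ c → ≤-reflexive (trans (∑-same-line c) order≡))
        τ≤1 hole)

-- The colouring and the union bound

open FiniteDomain using (order)

∈-vecs : {xs : List A} → (∀ x → x ∈ xs) → ∀ {n} (v : Vec A n) → v ∈ vecs xs n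
∈-vecs all []      = here refl
∈-vecs all (x ∷ v) = ∈-cartesianProductWith⁺ _∷_ (all x) (∈-vecs all v)

^-cancelʳ-≤ : ∀ n {a b} → 1 ≤ n → a ^ n ≤ b ^ n → a ≤ b
^-cancelʳ-≤ n@(suc _) {a} {b} _ aⁿ≤bⁿ with a ≤? b
... | yes a≤b = a≤b
... | no  a≰b = contradiction aⁿ≤bⁿ (<⇒≱ (^-monoˡ-< n (≰⇒> a≰b)))

increasing⇒injective : ∀ {m N} {f : Fin m → Fin N} → StrictlyIncreasing f → Injective _≡_ _≡_ f
increasing⇒injective {f = f} inc {i} {j} eq with Fin.<-cmp i j
... | tri< i<j _ _ = contradiction (cong toℕ eq) (<⇒≢ (inc i j i<j))
... | tri≈ _ i≡j _ = i≡j
... | tri> _ _ j<i = contradiction (cong toℕ (sym eq)) (<⇒≢ (inc j i j<i))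

-- Positions in the three intervals

module _ (n : ℕ) where

  first : Fin n → Fin (3 * n)
  first i = i ↑ˡ (n + (n + 0))

  -- The middle and last intervals share the index type `Fin (n + n)`, so that one use of `∑-vecs-∏`
  -- handles all 2n entries of a row. The cast absorbs the `n + 0` inside `3 * n`.
  later : Fin (n + n) → Fin (3 * n)
  later j = n ↑ʳ Fin.cast (cong (n +_) (sym (+-identityʳ n))) j

  middle last : Fin n → Fin (3 * n)
  middle j = later (j ↑ˡ n)
  last k   = later (n ↑ʳ k)

  toℕ-first : ∀ i → toℕ (first i) ≡ toℕ i
  toℕ-first i = Fin.toℕ-↑ˡ i _

  toℕ-later : ∀ j → toℕ (later j) ≡ n + toℕ j
  toℕ-later j = trans (Fin.toℕ-↑ʳ n _) (cong (n +_) (Fin.toℕ-cast _ j))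

  toℕ-middle : ∀ j → toℕ (middle j) ≡ n + toℕ j
  toℕ-middle j = trans (toℕ-later _) (cong (n +_) (Fin.toℕ-↑ˡ j n))

  toℕ-last : ∀ k → toℕ (last k) ≡ n + (n + toℕ k)
  toℕ-last k = trans (toℕ-later _) (cong (n +_) (Fin.toℕ-↑ʳ n k))

  later-injective : Injective _≡_ _≡_ later
  later-injective {i} {j} eq = Fin.toℕ-injective (+-cancelˡ-≡ n _ _
    (trans (sym (toℕ-later i)) (trans (cong toℕ eq) (toℕ-later j))))

  first<middle : ∀ i j → toℕ (first i) < toℕ (middle j)
  first<middle i j = subst₂ _<_ (sym (toℕ-first i)) (sym (toℕ-middle j)) (≤-trans (Fin.toℕ<n i) (m≤m+n n _))

  middle<last : ∀ j k → toℕ (middle j) < toℕ (last k)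
  middle<last j k = subst₂ _<_ (sym (toℕ-middle j)) (sym (toℕ-last k))
    (+-monoʳ-< n (≤-trans (Fin.toℕ<n j) (m≤m+n n _)))

  tripartite-edge : ∀ i j k → Edge (K3tri n) (first i) (middle j) (last k)
  tripartite-edge i j k =
      subst (_< n) (sym (toℕ-first i)) (Fin.toℕ<n i)
    , ( subst (n ≤_) (sym (toℕ-middle j)) (m≤m+n n _)
      , subst₂ _<_ (sym (toℕ-middle j)) 2n≡ (+-monoʳ-< n (Fin.toℕ<n j)))
    , subst₂ _≤_ 2n≡ (sym (toℕ-last k)) (+-monoʳ-≤ n (m≤m+n n _))
    where
    2n≡ : n + n ≡ 2 * n
    2n≡ = cong (n +_) (sym (+-identityʳ n))

-- Vertex a carries a map f a into V, and a triple a < b < c is blue iff f a b ⇝ f a c.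
module LinkColouring {V : Set} (_⇝_ : V → V → Set) (_⇝?_ : ∀ b c → Dec (b ⇝ c))
  (no-triangle : ∀ {b c e} → b ⇝ c → c ⇝ e → b ⇝ e → ⊥) where

  colour : Dec P → Colour
  colour d = if does d then blue else red

  colour-blue : (d : Dec P) → colour d ≡ blue → P
  colour-blue (yes p) _ = p

  colour-red : (d : Dec P) → colour d ≡ red → ¬ P
  colour-red (no ¬p) _ = ¬p

  module _ {N : ℕ} (f : Fin N → Fin N → V) where

    χ : Colouring N
    χ a b c = colour (f a b ⇝? f a c)

    no-blue-copy : ∀ t → 3 ≤ t → ¬ HasCopy χ blue (K3 (t + 1))
    no-blue-copy (suc (suc (suc s))) (s≤s (s≤s (s≤s _))) (g , _ , blue-edges) = no-triangle
      (edge v₀ v₁ v₂ (s≤s z≤n) (s≤s (s≤s z≤n)))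
      (edge v₀ v₂ v₃ (s≤s z≤n) (s≤s (s≤s (s≤s z≤n))))
      (edge v₀ v₁ v₃ (s≤s z≤n) (s≤s (s≤s z≤n)))
      where
      v₀ v₁ v₂ v₃ : Fin (3 + s + 1)
      v₀ = zero
      v₁ = suc zero
      v₂ = suc (suc zero)
      -- `s + 1` does not reduce to a successor, so the fourth vertex is taken to be the last one.
      v₃ = suc (suc (suc (s ↑ʳ zero)))
      edge : ∀ i j k → toℕ i < toℕ j → toℕ j < toℕ k → f (g i) (g j) ⇝ f (g i) (g k)
      edge i j k i<j j<k = colour-blue (_ ⇝? _) (blue-edges i j k i<j j<k (i<j , j<k))

    red-copy : ∀ n → HasCopy χ red (K3tri n) → ∃ λ (g : Fin (3 * n) → Fin N) → Injective _≡_ _≡_ g ×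
      (∀ i j k → ¬ (f (g (first n i)) (g (middle n j)) ⇝ f (g (first n i)) (g (last n k))))
    red-copy n (g , increasing , red-edges) = g , increasing⇒injective increasing , λ i j k →
      colour-red (_ ⇝? _) (red-edges _ _ _ (first<middle n i j) (middle<last n j k) (tripartite-edge n i j k))

^-distribʳ-* : ∀ n a b → (a * b) ^ n ≡ a ^ n * b ^ n
^-distribʳ-* zero    a b = refl
^-distribʳ-* (suc n) a b = trans (cong (a * b *_) (^-distribʳ-* n a b))
  (solve 4 (λ a b c d → a :* b :* (c :* d) := a :* c :* (b :* d)) refl a b (a ^ n) (b ^ n))

-- Weights of placements and their averages

module Counting {V : Set} (vs : List V) (complete : ∀ v → v ∈ vs) (_≟_ : DecidableEquality V)
  (_⇝_ : V → V → Set) (_⇝?_ : ∀ b c → Dec (b ⇝ c))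
  (no-triangle : ∀ {b c e} → b ⇝ c → c ⇝ e → b ⇝ e → ⊥) where

  open DecMembership _≟_ using (_∈?_)
  open LinkColouring _⇝_ _⇝?_ no-triangle

  -- Indicators of a set S and of the largest T that receives no edge from S. Since S determines T,
  -- the union bound runs over 2^l sets rather than over pairs.
  inside avoided : List V → V → ℕ
  inside s b  = ⟦ b ∈? s ⟧
  avoided s c = ⟦ All.all? (λ b → ¬? (b ⇝? c)) s ⟧

  module _ (M : ℕ) (hole : ∀ s → ∑ vs (inside s) * ∑ vs (avoided s) ≤ M) (n N : ℕ) where

    l ρ : ℕ
    l = length vs
    ρ = l ^ N

    rows : List (Vec V N)
    rows = vecs vs N

    length-rows : length rows ≡ ρ
    length-rows = length-vecs vs N

    side : List V → Fin n ⊎ Fin n → V → ℕ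
    side s = [ (λ _ → inside s) , (λ _ → avoided s) ]′

    -- `φ` lists the vertices of a prospective copy and `r` is the map of one vertex of its first
    -- interval. The sum counts the S for which `r` sends the middle interval into S and the last
    -- into T.
    rowWeight : Vec (Fin N) (3 * n) → Vec V N → ℕ
    rowWeight φ r = ∑ (sublists vs) (λ s → ∏ (n + n) (λ i → side s (splitAt n i) (lookup r (lookup φ (later n i)))))

    weight : Vec (Fin N) (3 * n) → Vec (Vec V N) N → ℕ
    weight φ f = ∏ n (λ i → rowWeight φ (lookup f (lookup φ (first n i))))

    -- `G` is abstract to cover two uses: sums over all of `vs` in `box`, and values at the entries
    -- of a row in `caught`.
    ∏-split : ∀ s (G : (V → ℕ) → Fin (n + n) → ℕ) →
      ∏ (n + n) (λ i → G (side s (splitAt n i)) i)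
        ≡ ∏ n (λ j → G (inside s) (j ↑ˡ n)) * ∏ n (λ k → G (avoided s) (n ↑ʳ k))
    ∏-split s G = trans (∏-+ n n _) (cong₂ _*_
      (∏-cong n (λ j → cong (λ p → G (side s p) (j ↑ˡ n)) (Fin.splitAt-↑ˡ n j n)))
      (∏-cong n (λ k → cong (λ p → G (side s p) (n ↑ʳ k)) (Fin.splitAt-↑ʳ n n k))))

    Distinct : Vec (Fin N) (3 * n) → Set
    Distinct φ = ∀ i j → lookup φ i ≡ lookup φ j → i ≡ j

    distinct? : ∀ φ → Dec (Distinct φ)
    distinct? φ = Fin.all? λ i → Fin.all? λ j → (lookup φ i Fin.≟ lookup φ j) →-dec (i Fin.≟ j)

    -- For fixed S the 2n entries are independent and contribute (|S||T|)ⁿ ≤ Mⁿ; there are 2^l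
    -- choices of S.
    ∑-rowWeight : ∀ φ → Distinct φ → ∑ rows (rowWeight φ) * l ^ (n + n) ≤ 2 ^ l * (ρ * M ^ n)
    ∑-rowWeight φ distinct = begin
      ∑ rows (rowWeight φ) * l ^ (n + n)
        ≡⟨ cong (_* l ^ (n + n)) (∑-swap rows (sublists vs) _) ⟩
      ∑ (sublists vs) (λ s → ∑ rows (λ r → boxed s r)) * l ^ (n + n)
        ≡⟨ ∑-*ʳ (sublists vs) _ (l ^ (n + n)) ⟨
      ∑ (sublists vs) (λ s → ∑ rows (λ r → boxed s r) * l ^ (n + n))
        ≤⟨ ∑-mono (sublists vs) box ⟩
      ∑ (sublists vs) (λ s → ρ * M ^ n)
        ≡⟨ ∑-const (sublists vs) _ ⟩
      length (sublists vs) * (ρ * M ^ n)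
        ≡⟨ cong (_* (ρ * M ^ n)) (length-sublists vs) ⟩
      2 ^ l * (ρ * M ^ n) ∎
      where
      open ≤-Reasoning
      boxed : List V → Vec V N → ℕ
      boxed s r = ∏ (n + n) (λ i → side s (splitAt n i) (lookup r (lookup φ (later n i))))
      box : ∀ s → ∑ rows (boxed s) * l ^ (n + n) ≤ ρ * M ^ n
      box s = begin
        ∑ rows (boxed s) * l ^ (n + n)
          ≡⟨ ∑-vecs-∏ vs N (n + n) (lookup φ ∘ later n) (λ eq → later-injective n (distinct _ _ eq)) (side s ∘ splitAt n) ⟩
        ρ * ∏ (n + n) (λ i → ∑ vs (side s (splitAt n i)))
          ≡⟨ cong (ρ *_) (∏-split s (λ F _ → ∑ vs F)) ⟩
        ρ * (∏ n (λ _ → ∑ vs (inside s)) * ∏ n (λ _ → ∑ vs (avoided s)))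
          ≡⟨ cong (ρ *_) (trans (cong₂ _*_ (∏-const n _) (∏-const n _)) (sym (^-distribʳ-* n _ _))) ⟩
        ρ * (∑ vs (inside s) * ∑ vs (avoided s)) ^ n
          ≤⟨ *-monoʳ-≤ ρ (^-monoˡ-≤ n (hole s)) ⟩
        ρ * M ^ n ∎

    -- The denominators of both uses of independence: `ρ` for each of the n rows and `l ^ (n + n)`
    -- for the entries within each.
    scale : ℕ
    scale = ρ ^ n * (l ^ (n + n)) ^ n

    -- The maps of the n vertices in the first interval are independent rows, so the bound for one
    -- row is raised to the power n.
    ∑-weight : ∀ φ → Distinct φ → ∑ (vecs rows N) (weight φ) * scale ≤ ρ ^ N * (2 ^ l * (ρ * M ^ n)) ^ n
    ∑-weight φ distinct = begin
      ∑ (vecs rows N) (weight φ) * (ρ ^ n * (l ^ (n + n)) ^ n)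
        ≡⟨ *-assoc (∑ (vecs rows N) (weight φ)) _ _ ⟨
      ∑ (vecs rows N) (weight φ) * ρ ^ n * (l ^ (n + n)) ^ n
        ≡⟨ cong (_* (l ^ (n + n)) ^ n) independent ⟩
      ρ ^ N * ∑ rows (rowWeight φ) ^ n * (l ^ (n + n)) ^ n
        ≡⟨ trans (*-assoc (ρ ^ N) _ _) (cong (ρ ^ N *_) (sym (^-distribʳ-* n _ _))) ⟩
      ρ ^ N * (∑ rows (rowWeight φ) * l ^ (n + n)) ^ n
        ≤⟨ *-monoʳ-≤ (ρ ^ N) (^-monoˡ-≤ n (∑-rowWeight φ distinct)) ⟩
      ρ ^ N * (2 ^ l * (ρ * M ^ n)) ^ n ∎
      where
      open ≤-Reasoning
      first-injective : Injective _≡_ _≡_ (lookup φ ∘ first n)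
      first-injective eq = Fin.↑ˡ-injective _ _ _ (distinct _ _ eq)
      independent : ∑ (vecs rows N) (weight φ) * ρ ^ n ≡ ρ ^ N * ∑ rows (rowWeight φ) ^ n
      independent = trans
        (subst (λ ρ → ∑ (vecs rows N) (weight φ) * ρ ^ n ≡ ρ ^ N * ∏ n (λ _ → ∑ rows (rowWeight φ))) length-rows
          (∑-vecs-∏ rows N n (lookup φ ∘ first n) first-injective (λ _ → rowWeight φ)))
        (cong (ρ ^ N *_) (∏-const n _))

    placements : List (Vec (Fin N) (3 * n))
    placements = filter distinct? (vecs (allFin N) (3 * n))

    length-placements : length placements ≤ N ^ (3 * n)
    length-placements = ≤-trans (length-filter distinct? (vecs (allFin N) (3 * n))) (≤-reflexive
      (trans (length-vecs (allFin N) (3 * n)) (cong (_^ (3 * n)) (length-tabulate id))))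

    -- For a red copy, take s to be the set of all v sending no edge to the images of the last interval.
    caught : ∀ {t} → 3 ≤ t → Arrows N (K3 (t + 1)) (K3tri n) →
      ∀ f → ∃ λ φ → φ ∈ placements × 1 ≤ weight φ f
    caught {t} 3≤t arrows f with arrows (χ (λ a → lookup (lookup f a)))
    ... | inj₁ blue-copy = contradiction blue-copy (no-blue-copy (λ a → lookup (lookup f a)) t 3≤t)
    ... | inj₂ copy with g , g-injective , g-red ← red-copy (λ a → lookup (lookup f a)) n copy =
      φ , ∈-filter⁺ distinct? (∈-vecs ∈-allFin φ) distinct , ∏≥1 n row≥1
      where
      φ : Vec (Fin N) (3 * n)
      φ = tabulate g
      distinct : Distinct φ
      distinct i j eq = g-injective (trans (sym (lookup∘tabulate g i)) (trans eq (lookup∘tabulate g j)))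
      row≥1 : ∀ i → 1 ≤ rowWeight φ (lookup f (lookup φ (first n i)))
      row≥1 i = ≤-trans (subst (1 ≤_) (sym (∏-split s (λ F i → F (at (later n i)))))
          (*-mono-≤ (∏≥1 n inside≥1) (∏≥1 n avoided≥1)))
        (∈⇒≤∑ (λ s → ∏ (n + n) (λ i → side s (splitAt n i) (at (later n i)))) (filter∈sublists good? vs))
        where
        at : Fin (3 * n) → V
        at p = lookup (lookup f (lookup φ (first n i))) (lookup φ p)
        Good : V → Set
        Good v = ∀ k → ¬ (v ⇝ at (last n k))
        good? : ∀ v → Dec (Good v)
        good? v = Fin.all? λ k → ¬? (v ⇝? at (last n k))
        s : List V
        s = filter good? vs
        good-middle : ∀ j → Good (at (middle n j))
        good-middle j k
          rewrite lookup∘tabulate g (first n i) | lookup∘tabulate g (middle n j) | lookup∘tabulate g (last n k)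
          = g-red i j k
        inside≥1 : ∀ j → 1 ≤ inside s (at (middle n j))
        inside≥1 j = ≤-reflexive (sym (⟦⟧-yes (at (middle n j) ∈? s) (∈-filter⁺ good? (complete _) (good-middle j))))
        avoided≥1 : ∀ k → 1 ≤ avoided s (at (last n k))
        avoided≥1 k = ≤-reflexive (sym (⟦⟧-yes (All.all? (λ b → ¬? (b ⇝? at (last n k))) s)
          (All.tabulate (λ b∈s → proj₂ (∈-filter⁻ good? {xs = vs} b∈s) k))))

    -- The union bound over at most N^(3n) placements is, after cancelling `ρ ^ N`, an inequality
    -- between n-th powers. Taking the root leaves N³ for the placements and a single 2^l.
    ramsey-bound : .{{_ : NonZero l}} → 1 ≤ n → ∀ {t} → 3 ≤ t → Arrows N (K3 (t + 1)) (K3tri n) →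
      l ^ (n + n) ≤ N ^ 3 * (2 ^ l * M ^ n)
    ramsey-bound 1≤n 3≤t arrows = *-cancelˡ-≤ ρ {{ρ≢0}} (^-cancelʳ-≤ n 1≤n (begin
      (ρ * l ^ (n + n)) ^ n
        ≡⟨ ^-distribʳ-* n ρ _ ⟩
      scale
        ≤⟨ *-cancelˡ-≤ (ρ ^ N) {{m^n≢0 ρ N {{ρ≢0}}}} counted ⟩
      N ^ (3 * n) * (2 ^ l * (ρ * M ^ n)) ^ n
        ≡⟨ cong (_* (2 ^ l * (ρ * M ^ n)) ^ n) (^-*-assoc N 3 n) ⟨
      (N ^ 3) ^ n * (2 ^ l * (ρ * M ^ n)) ^ n
        ≡⟨ ^-distribʳ-* n (N ^ 3) _ ⟨
      (N ^ 3 * (2 ^ l * (ρ * M ^ n))) ^ n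
        ≡⟨ cong (_^ n) (solve 4 (λ a b c d → a :* (b :* (c :* d)) := c :* (a :* (b :* d))) refl (N ^ 3) (2 ^ l) ρ (M ^ n)) ⟩
      (ρ * (N ^ 3 * (2 ^ l * M ^ n))) ^ n ∎))
      where
      open ≤-Reasoning
      ρ≢0 : NonZero ρ
      ρ≢0 = m^n≢0 l N
      counted : ρ ^ N * scale ≤ ρ ^ N * (N ^ (3 * n) * (2 ^ l * (ρ * M ^ n)) ^ n)
      counted = begin
        ρ ^ N * scale
          ≡⟨ cong (_* scale) (trans (length-vecs rows N) (cong (_^ N) length-rows)) ⟨
        length (vecs rows N) * scale
          ≤⟨ *-monoˡ-≤ scale (union-bound (vecs rows N) placements weight (caught 3≤t arrows)) ⟩
        ∑ placements (λ φ → ∑ (vecs rows N) (weight φ)) * scale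
          ≡⟨ ∑-*ʳ placements _ scale ⟨
        ∑ placements (λ φ → ∑ (vecs rows N) (weight φ) * scale)
          ≤⟨ ∑-mono-∈ placements (λ {φ} φ∈ →
               ∑-weight φ (proj₂ (∈-filter⁻ distinct? {xs = vecs (allFin N) (3 * n)} φ∈))) ⟩
        ∑ placements (λ _ → ρ ^ N * (2 ^ l * (ρ * M ^ n)) ^ n)
          ≡⟨ ∑-const placements _ ⟩
        length placements * (ρ ^ N * (2 ^ l * (ρ * M ^ n)) ^ n)
          ≤⟨ *-monoˡ-≤ _ length-placements ⟩
        N ^ (3 * n) * (ρ ^ N * (2 ^ l * (ρ * M ^ n)) ^ n)
          ≡⟨ solve 3 (λ a b c → a :* (b :* c) := b :* (a :* c)) refl (N ^ (3 * n)) (ρ ^ N) ((2 ^ l * (ρ * M ^ n)) ^ n) ⟩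
        ρ ^ N * (N ^ (3 * n) * (2 ^ l * (ρ * M ^ n)) ^ n) ∎


-- Choice of the field

cube : ℕ → ℕ
cube q = q * (q * q)

cube≢0 : ∀ q .{{_ : NonZero q}} → NonZero (cube q)
cube≢0 q = m*n≢0 q (q * q) {{it}} {{m*n≢0 q q}}

flag-bound : ∀ (R : FiniteDomain) → .{{_ : NonZero (order R)}} → ∀ {n N t} → 1 ≤ n → 3 ≤ t →
  Arrows N (K3 (t + 1)) (K3tri n) → let q = order R in
  cube q ^ (n + n) ≤ N ^ 3 * (2 ^ cube q * (5 * q ^ 5) ^ n)
flag-bound R {n} {N} 1≤n 3≤t arrows =
  subst (λ l → l ^ (n + n) ≤ N ^ 3 * (2 ^ l * (5 * order R ^ 5) ^ n)) length-flags
    (ramsey-bound (5 * order R ^ 5) hole n N {{l≢0}} 1≤n 3≤t arrows)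
  where
  open Flags R
  open Counting flags ∈-flags _≟ᶠ_ _⇝_ _⇝?_ no-transitive-triangle
  open DecMembership _≟ᶠ_ using (_∈?_)
  l≢0 : NonZero (length flags)
  l≢0 = subst NonZero (sym length-flags) (cube≢0 (order R))
  hole : ∀ s → ∑ flags (inside s) * ∑ flags (avoided s) ≤ 5 * order R ^ 5
  hole s = flags-hole-bound (inside s) (avoided s) (λ c → ⟦⟧≤1 (All.all? (λ b → ¬? (b ⇝? c)) s)) separated
    where
    separated : ∀ b → inside s b ≡ 0 ⊎ (inside s b ≤ 1 × (∀ c → avoided s c * ⟦ b ⇝? c ⟧ ≡ 0))
    separated b with b ∈? s
    ... | no _    = inj₁ refl
    ... | yes b∈s = inj₂ (≤-refl , no-edge)
      where
      no-edge : ∀ c → avoided s c * ⟦ b ⇝? c ⟧ ≡ 0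
      no-edge c with All.all? (λ b → ¬? (b ⇝? c)) s
      ... | no _      = refl
      ... | yes avoid = cong (1 *_) (⟦⟧-no (b ⇝? c) (All.lookup avoid b∈s))

module _ {q n N : ℕ} .{{_ : NonZero q}} (q³≤n : cube q ≤ n) (100≤q : 100 ≤ q)
  (bound : cube q ^ (n + n) ≤ N ^ 3 * (2 ^ cube q * (5 * q ^ 5) ^ n)) where

  open ≤-Reasoning

  -- The left side of `bound` is q^(6n), of which q^(5n) cancels; q³ ≤ n turns 2^(q³) into 2ⁿ, which
  -- joins 5ⁿ.
  qⁿ≤N³10ⁿ : q ^ n ≤ N ^ 3 * 10 ^ n
  qⁿ≤N³10ⁿ = *-cancelʳ-≤ _ _ ((q ^ 5) ^ n) {{m^n≢0 (q ^ 5) n {{m^n≢0 q 5}}}} (begin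
    q ^ n * (q ^ 5) ^ n
      ≡⟨ ^-distribʳ-* n q (q ^ 5) ⟨
    (q * q ^ 5) ^ n
      ≡⟨ cong (_^ n) (solve 1 (λ q → q :* q :^ 5 := q :* (q :* q) :* (q :* (q :* q))) refl q) ⟩
    (cube q * cube q) ^ n
      ≡⟨ ^-distribʳ-* n (cube q) (cube q) ⟩
    cube q ^ n * cube q ^ n
      ≡⟨ ^-distribˡ-+-* (cube q) n n ⟨
    cube q ^ (n + n)
      ≤⟨ bound ⟩
    N ^ 3 * (2 ^ cube q * (5 * q ^ 5) ^ n)
      ≤⟨ *-monoʳ-≤ (N ^ 3) (*-monoˡ-≤ _ (^-monoʳ-≤ 2 q³≤n)) ⟩
    N ^ 3 * (2 ^ n * (5 * q ^ 5) ^ n)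
      ≡⟨ cong (N ^ 3 *_) (^-distribʳ-* n 2 (5 * q ^ 5)) ⟨
    N ^ 3 * (2 * (5 * q ^ 5)) ^ n
      ≡⟨ cong (λ z → N ^ 3 * z ^ n) (*-assoc 2 5 (q ^ 5)) ⟨
    N ^ 3 * (10 * q ^ 5) ^ n
      ≡⟨ cong (N ^ 3 *_) (^-distribʳ-* n 10 (q ^ 5)) ⟩
    N ^ 3 * (10 ^ n * (q ^ 5) ^ n)
      ≡⟨ *-assoc (N ^ 3) (10 ^ n) _ ⟨
    N ^ 3 * 10 ^ n * (q ^ 5) ^ n ∎)

  -- Squaring turns 10ⁿ into 100ⁿ, which one of the two factors qⁿ absorbs because 100 ≤ q.
  qⁿ≤N⁶ : q ^ n ≤ N ^ 6
  qⁿ≤N⁶ = *-cancelʳ-≤ _ _ (q ^ n) {{m^n≢0 q n}} (begin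
    q ^ n * q ^ n
      ≤⟨ *-mono-≤ qⁿ≤N³10ⁿ qⁿ≤N³10ⁿ ⟩
    N ^ 3 * 10 ^ n * (N ^ 3 * 10 ^ n)
      ≡⟨ solve 2 (λ N a → N :^ 3 :* a :* (N :^ 3 :* a) := N :^ 6 :* (a :* a)) refl N (10 ^ n) ⟩
    N ^ 6 * (10 ^ n * 10 ^ n)
      ≡⟨ cong (N ^ 6 *_) (^-distribʳ-* n 10 10) ⟨
    N ^ 6 * 100 ^ n
      ≤⟨ *-monoʳ-≤ (N ^ 6) (^-monoˡ-≤ n 100≤q) ⟩
    N ^ 6 * q ^ n ∎)

  nⁿ≤N³⁶ : n ≤ q ^ 6 → n ^ n ≤ N ^ 36
  nⁿ≤N³⁶ n≤q⁶ = begin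
    n ^ n          ≤⟨ ^-monoˡ-≤ n n≤q⁶ ⟩
    (q ^ 6) ^ n    ≡⟨ ^-*-assoc q 6 n ⟩
    q ^ (6 * n)    ≡⟨ cong (q ^_) (*-comm 6 n) ⟩
    q ^ (n * 6)    ≡⟨ ^-*-assoc q n 6 ⟨
    (q ^ n) ^ 6    ≤⟨ ^-monoˡ-≤ 6 qⁿ≤N⁶ ⟩
    (N ^ 6) ^ 6    ≡⟨ ^-*-assoc N 6 6 ⟩
    N ^ 36         ∎

-- A crude linear bound that gives both 100 ≤ q and, for `bracket`, the unboundedness of the orders.
625+j≤order : ∀ j → 625 + j ≤ order-𝔽 j
625+j≤order zero    = ≤-reflexive (sym order-𝔽-zero)
625+j≤order (suc j) = begin
  625 + suc j              ≡⟨ +-comm 625 (suc j) ⟩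
  suc j + 625              ≡⟨ cong suc (+-comm j 625) ⟩
  1 + (625 + j)            ≤⟨ +-mono-≤ (≤-trans (s≤s z≤n) (625+j≤order j)) (625+j≤order j) ⟩
  order-𝔽 j + order-𝔽 j    ≡⟨ cong (order-𝔽 j +_) (+-identityʳ (order-𝔽 j)) ⟨
  2 * order-𝔽 j            ≤⟨ *-monoˡ-≤ (order-𝔽 j) (≤-trans (s≤s (s≤s z≤n)) (625+j≤order j)) ⟩
  order-𝔽 j * order-𝔽 j    ≡⟨ order-𝔽-suc j ⟨
  order-𝔽 (suc j)          ∎
  where open ≤-Reasoning

order-𝔽≢0 : ∀ j → NonZero (order-𝔽 j)
order-𝔽≢0 j = >-nonZero (≤-trans (s≤s z≤n) (625+j≤order j))

m≤m³ : ∀ m → m ≤ cube m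
m≤m³ zero      = z≤n
m≤m³ m@(suc _) = m≤m*n m (m * m)

m³≤m⁶ : ∀ m .{{_ : NonZero m}} → cube m ≤ m ^ 6
m³≤m⁶ m = begin
  cube m            ≤⟨ m≤m*n (cube m) (cube m) {{cube≢0 m}} ⟩
  cube m * cube m   ≡⟨ solve 1 (λ q → q :* (q :* q) :* (q :* (q :* q)) := q :^ 6) refl m ⟩
  m ^ 6             ∎
  where open ≤-Reasoning

-- Consecutive field orders are q and q², so every large n lies between some q³ and q⁶.
bracket : ∀ n → cube (order-𝔽 0) ≤ n → ∃ λ j → cube (order-𝔽 j) ≤ n × n ≤ order-𝔽 j ^ 6
bracket n small≤n = search n (≤-trans (≤-trans (m≤n+m n 625) (625+j≤order n)) (m≤m³ (order-𝔽 n)))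
  where
  search : ∀ k → n ≤ cube (order-𝔽 k) → ∃ λ j → cube (order-𝔽 j) ≤ n × n ≤ order-𝔽 j ^ 6
  search zero    n≤ = 0 , small≤n , ≤-trans n≤ (m³≤m⁶ (order-𝔽 0) {{order-𝔽≢0 0}})
  search (suc k) n≤ with cube (order-𝔽 k) ≤? n
  ... | no  n≱ = search k (<⇒≤ (≰⇒> n≱))
  ... | yes ≤n = k , ≤n , ≤-trans n≤ (≤-reflexive (trans (cong cube (order-𝔽-suc k))
    (solve 1 (λ q → q :* q :* (q :* q :* (q :* q)) := q :^ 6) refl (order-𝔽 k))))

large-case : ∀ {t n N} → 3 ≤ t → 1 ≤ n → cube (order-𝔽 0) ≤ n → Arrows N (K3 (t + 1)) (K3tri n) → n ^ n ≤ N ^ 36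
large-case {n = n} {N} 3≤t 1≤n large arrows with j , q³≤n , n≤q⁶ ← bracket n large =
  nⁿ≤N³⁶ {order-𝔽 j} {n} {N} {{order-𝔽≢0 j}} q³≤n (≤-trans (m≤m+n 100 525) (≤-trans (m≤m+n 625 j) (625+j≤order j)))
    (flag-bound (𝔽 j) {{order-𝔽≢0 j}} 1≤n 3≤t arrows) n≤q⁶

-- The all-red colouring has no blue edge, so it must contain a red copy, which embeds 3n vertices.
arrows⇒3n≤N : ∀ {t n N} → 3 ≤ t → Arrows N (K3 (t + 1)) (K3tri n) → 3 * n ≤ N
arrows⇒3n≤N (s≤s (s≤s (s≤s _))) arrows with arrows (λ _ _ _ → red)
... | inj₂ (g , increasing , _) = Fin.injective⇒≤ (increasing⇒injective increasing)
... | inj₁ (_ , _ , blue-edges)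
    with () ← blue-edges zero (suc zero) (suc (suc zero)) (s≤s z≤n) (s≤s (s≤s z≤n)) (s≤s z≤n , s≤s (s≤s z≤n))

-- The exponent is a variable k, since unfolding N ^ 244140661 during conversion would be fatal.
uniform-bound : ∀ k {t n N} → 3 ≤ t → 1 ≤ n → k ≡ cube (order-𝔽 0) → Arrows N (K3 (t + 1)) (K3tri n) →
  n ^ (1 * n) ≤ N ^ (36 + k)
uniform-bound k {t} {n} {N} 3≤t 1≤n k≡ arrows = begin
  n ^ (1 * n)     ≡⟨ cong (n ^_) (*-identityˡ n) ⟩
  n ^ n           ≤⟨ cases (k ≤? n) ⟩
  N ^ (36 + k)    ∎
  where
  open ≤-Reasoning
  n≤N : n ≤ N
  n≤N = ≤-trans (m≤m+n n (n + (n + 0))) (arrows⇒3n≤N 3≤t arrows)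
  N≢0 : NonZero N
  N≢0 = >-nonZero (≤-trans 1≤n n≤N)
  cases : Dec (k ≤ n) → n ^ n ≤ N ^ (36 + k)
  cases (yes k≤n) = ≤-trans (large-case 3≤t 1≤n (subst (_≤ n) k≡ k≤n) arrows) (^-monoʳ-≤ N {{N≢0}} (m≤m+n 36 k))
  -- For n < k the bound n ≤ N suffices: nⁿ ≤ Nⁿ ≤ Nᵏ. The exponent 36 + k covers both ranges.
  cases (no  k≰n) = ≤-trans (^-monoˡ-≤ n n≤N) (^-monoʳ-≤ N {{N≢0}} (≤-trans (<⇒≤ (≰⇒> k≰n)) (m≤n+m k 36)))

-- Taking logarithms, the conclusion reads N ≥ 2^(c n log n) with the rational constant c = p/q.
-- Here p = 1 and q = 36 + 625³ for every t.
theorem2 : (t : ℕ) → 3 ≤ t →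
    Σ ℕ λ p → Σ ℕ λ q → 1 ≤ p × 1 ≤ q ×
    ((n : ℕ) → 1 ≤ n → (N : ℕ) → Arrows N (K3 (t + 1)) (K3tri n) →
    n ^ (p * n) ≤ N ^ q)
theorem2 t 3≤t = 1 , 36 + cube (order-𝔽 0) , ≤-refl , s≤s z≤n ,
  λ n 1≤n N arrows → uniform-bound (cube (order-𝔽 0)) 3≤t 1≤n refl arrows
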